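{- Consider an instance of the add-on discount revenue management problem and let $V(OPT)$ be its optimal value. Suppose $V(OPT)\ge v^*$. For any problem instance and any $\varepsilon>0$, the Discretized DP Algorithm run with parameter $$K=\left\lceil \frac{\hat p M N}{v^*\cdot\varepsilon}\right\rceil$$ outputs a $(1-\varepsilon)$-optimal policy $ALG$, i.e. $V(OPT)-V(ALG)\le\varepsilon\, V(OPT)$, with running time polynomial in both the problem size and $1/\varepsilon$. In other words, the algorithm is an FPTAS (fully polynomial-time approximation scheme).
   Context: **Problem.** There are $N$ core products and $M$ supportive products, finite sets $\Omega_c,\Omega_s,\Omega_a$ of nonnegative prices (for core products, supportive products and add-on discounts), an integer $S\ge 0$, and demand functions $\alpha_n:\Omega_c\to[0,1]$ ($n=1,\dots,N$), $\alpha_{N+m}:\Omega_s\to[0,1]$, $\beta_{N+m}:\Omega_s\to[0,1]$, $\beta'_{N+m}:\Omega_a\to[0,1]$ ($m=1,\dots,M$). A feasible policy $\pi$ specifies $p_n\in\Omega_c$ for $n=1,\dots,N$ and $p_{N+m}\in\Omega_s$, $p'_{N+m}\in\Omega_a$, $I_{N+m}\in\{0,1\}$ for $m=1,\dots,M$, with $\sum_{m=1}^M I_{N+m}\le S$ and $p'_{N+m}<p_{N+m}$ for all $m=1,\dots,M$. Its value (expected revenue per period) is $$V(\pi)=\sum_{n=1}^N\alpha_n(p_n)p_n+\sum_{m=1}^M\alpha_{N+m}(p_{N+m})p_{N+m}+\Big[\sum_{n=1}^N\alpha_n(p_n)\Big]\sum_{m=1}^M\Big[I_{N+m}\beta'_{N+m}(p'_{N+m})p'_{N+m}+(1-I_{N+m})\beta_{N+m}(p_{N+m})p_{N+m}\Big].$$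 $OPT$ is a feasible policy maximizing $V$. $\hat p:=\max_{p\in\Omega_c\cup\Omega_s}p$ is the highest price among all the products. **Discretized DP Algorithm** (input: the price sets $\Omega_c,\Omega_s,\Omega_a$, all values of the demand functions $\alpha_n,\alpha_{N+m},\beta_{N+m},\beta'_{N+m}$ on their domains, and a positive integer constant $K$). Part 1. For each $m$ and each $\gamma\in\{0,\frac1K,\frac2K,\dots,\frac{NK}{K}\}$, compute $r_{N+m}(\gamma)=\max_{p\in\Omega_s}\{\alpha_{N+m}(p)p+\gamma\beta_{N+m}(p)p\}$ and $r'_{N+m}(\gamma)=\max_{p\in\Omega_s,\,p'\in\Omega_a,\,p'<p}\{\alpha_{N+m}(p)p+\gamma\beta'_{N+m}(p')p'\}$. For each such $\gamma$, sort the numbers $r'_{N+m}(\gamma)-r_{N+m}(\gamma)$ in descending order; set $I_{N+m}(\gamma)=1$ if this difference is positive and among the first $S$ entries, and $I_{N+m}(\gamma)=0$ otherwise. Set $\mathcal R_s(\gamma)=\sum_{m=1}^M\big[r_{N+m}(\gamma)+I_{N+m}(\gamma)(r'_{N+m}(\gamma)-r_{N+m}(\gamma))\big]$. Part 2. Let $\hat\alpha_n(p)$ be $\alpha_n(p)$ rounded to the nearest integer multiple of $1/K$. Solve by backward induction $V_{N+1}(\gamma)=\mathcal R_s(\gamma)$, $V_n(\gamma)=\max_{p_n\in\Omega_c}[\alpha_n(p_n)p_n+V_{n+1}(\gamma+\hat\alpha_n(p_n))]$. The output policy $ALG$ is given by the optimal decisions retrieved along the optimality equations starting from $V_1(0)$,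 together with the supportive decisions attaining $\mathcal R_s$ at the terminal value of $\gamma$. The problem size is measured by $N,M,|\Omega_c|,|\Omega_s|,|\Omega_a|$.
   Formalization: The running time is bounded by (1 + p̂/v*) times a polynomial in the problem size and 1/ε, since K grows with p̂/v*; p' < p is claimed for discounted products, and for all products only if every supportive price exceeds some add-on price. -}

module Defs where

open import Algebra.Bundles using (CommutativeRing)
import Algebra.Definitions.RawMonoid as RawMonoidDefs
open import Data.Bool.Base using (Bool; true; false; if_then_else_; not; _∧_)
open import Data.Fin.Base as Fin using (Fin; zero; suc; fromℕ; inject₁; fromℕ<)
import Data.Fin.Properties as Fin
open import Data.Fin.Subset using (Subset; ∣_∣; _∈_)
open import Data.List.Base as List using (List; []; _∷_; allFin; cartesianProduct)
import Data.List.Extrema as Extrema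
open import Data.List.NonEmpty.Base as List⁺ using (List⁺; _∷_)
open import Data.Maybe.Base using (Maybe; just; nothing)
open import Data.Nat.Base as ℕ using (ℕ; zero; suc; s≤s)
import Data.Nat.Properties as ℕ
open import Data.Product.Base using (_×_; _,_; ∃; ∃-syntax; proj₁; proj₂)
open import Data.Sum.Base using (_⊎_; inj₁; inj₂)
open import Data.Vec.Base using (Vec; []; _∷_; lookup; _∷ʳ_)
open import Function.Base using (id; _∘_)
open import Function.Definitions using (Injective)
open import Level using (Level; _⊔_; 0ℓ) renaming (suc to lsuc)
open import Relation.Binary.Bundles using (DecTotalOrder)
open import Relation.Binary.Core using (Rel)
open import Relation.Binary.PropositionalEquality.Core using (_≡_; refl)
open import Relation.Binary.Structures using (IsDecTotalOrder)
import Relation.Binary.Construct.NonStrictToStrict as NonStrictToStrict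
open import Relation.Nullary.Decidable.Core using (Dec; yes; no; does)
open import Relation.Nullary.Negation.Core using (¬_; contradiction)

private
  variable
    a b ℓ : Level
    A : Set a
    B : Set b

-- The scalars.  ℚ is a model, and so is ℝ in the presence of excluded middle.
-- As usual the inverse is total, and its value at 0# is left unspecified.

record ArchimedeanOrderedField c ℓ₁ ℓ₂ : Set (lsuc (c ⊔ ℓ₁ ⊔ ℓ₂)) where
  infix 4 _≤_
  infix 8 _⁻¹

  field
    commutativeRing : CommutativeRing c ℓ₁

  open CommutativeRing commutativeRing public renaming (zero to *-zero)

  open RawMonoidDefs +-rawMonoid public using (sum) renaming (_×_ to _·_)

  field
    _≤_             : Rel Carrier ℓ₂
    isDecTotalOrder : IsDecTotalOrder _≈_ _≤_
    +-monoʳ-≤       : ∀ x {y z} → y ≤ z → x + y ≤ x + z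
    *-nonNegative   : ∀ {x y} → 0# ≤ x → 0# ≤ y → 0# ≤ x * y
    0≉1             : 0# ≉ 1#
    _⁻¹             : Carrier → Carrier
    ⁻¹-cong         : ∀ {x y} → x ≈ y → x ⁻¹ ≈ y ⁻¹
    *-inverseʳ      : ∀ {x} → x ≉ 0# → x * x ⁻¹ ≈ 1#
    archimedean     : ∀ x → ∃[ n ] x ≤ n · 1#

  decTotalOrder : DecTotalOrder c ℓ₁ ℓ₂
  decTotalOrder = record { isDecTotalOrder = isDecTotalOrder }

  open DecTotalOrder decTotalOrder public using (_≤?_; totalOrder)
  open NonStrictToStrict _≈_ _≤_ public using (_<_)

  ⟨_⟩ : ℕ → Carrier
  ⟨ n ⟩ = n · 1#

-- Least natural numbers, by bounded search.

IsLeast : (ℕ → Set ℓ) → ℕ → Set ℓ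
IsLeast P n = P n × (∀ {m} → m ℕ.< n → ¬ P m)

private
  search : {P : ℕ → Set ℓ} → (∀ n → Dec (P n)) →
           ∀ n → ∃ (IsLeast P) ⊎ (∀ {m} → m ℕ.< n → ¬ P m)
  search P? zero = inj₂ λ ()
  search {P = P} P? (suc n) with search P? n
  ... | inj₁ found = inj₁ found
  ... | inj₂ below with P? n
  ...   | yes Pn = inj₁ (n , Pn , below)
  ...   | no ¬Pn = inj₂ (λ { (s≤s m≤n) → extend (ℕ.m≤n⇒m<n∨m≡n m≤n) })
    where
    extend : ∀ {m} → m ℕ.< n ⊎ m ≡ n → ¬ P m
    extend (inj₁ m<n)  = below m<n
    extend (inj₂ refl) = ¬Pn

least : {P : ℕ → Set ℓ} → (∀ n → Dec (P n)) → ∃ P → ∃ (IsLeast P)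
least P? (n , Pn) with search P? (suc n)
... | inj₁ found = found
... | inj₂ below = contradiction Pn (below (ℕ.n<1+n n))

-- Polynomials in n variables with natural number coefficients.

infixl 6 _:+_
infixl 7 _:*_

data Poly (n : ℕ) : Set where
  con       : ℕ → Poly n
  var       : Fin n → Poly n
  _:+_ _:*_ : Poly n → Poly n → Poly n

-- Computations with a step count.

infixl 1 _>>=_

record Timed (A : Set a) : Set a where
  constructor timed
  field
    value : A
    steps : ℕ

open Timed public

return : A → Timed A
return x = timed x 0

step : A → Timed A
step x = timed x 1

_>>=_ : Timed A → (A → Timed B) → Timed B
m >>= f = timed (value (f (value m))) (steps m ℕ.+ steps (f (value m)))

-- Filling a table: one step per cell in addition to computing its contents.

tabulateᵗ : ∀ {n} → (Fin n → Timed A) → Timed (Vec A n)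
tabulateᵗ {n = zero}  f = return []
tabulateᵗ {n = suc n} f = do
  x  ← f zero
  xs ← tabulateᵗ (f ∘ suc)
  step (x ∷ xs)

filterᵗ : (A → Timed Bool) → List A → Timed (List A)
filterᵗ p [] = return []
filterᵗ p (x ∷ xs) = do
  b  ← p x
  ys ← filterᵗ p xs
  step (if b then x ∷ ys else ys)

findᵗ : (A → Timed Bool) → A → List A → Timed A
findᵗ p default [] = step default
findᵗ p default (x ∷ xs) = do
  true ← p x
    where false → findᵗ p default xs
  step x

-- Whether i is among the first s entries.

amongFirstᵗ : ∀ {n} → ℕ → Fin n → List (Fin n) → Timed Bool
amongFirstᵗ zero    i xs       = step false
amongFirstᵗ (suc s) i []       = step false
amongFirstᵗ (suc s) i (x ∷ xs) = do
  true ← step (does (i Fin.≟ x))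
    where false → amongFirstᵗ s i xs
  return true

module AddOn {c ℓ₁ ℓ₂} (F : ArchimedeanOrderedField c ℓ₁ ℓ₂) where

  open ArchimedeanOrderedField F

  -- The ceiling of a nonnegative scalar.

  ⌈_⌉ : Carrier → ℕ
  ⌈ x ⌉ = proj₁ (least (λ n → x ≤? ⟨ n ⟩) (archimedean x))

  ⟦_⟧ : ∀ {n} → Poly n → Vec Carrier n → Carrier
  ⟦ con k ⟧  xs = ⟨ k ⟩
  ⟦ var i ⟧  xs = lookup xs i
  ⟦ p :+ q ⟧ xs = ⟦ p ⟧ xs + ⟦ q ⟧ xs
  ⟦ p :* q ⟧ xs = ⟦ p ⟧ xs * ⟦ q ⟧ xs

  UnitInterval : Carrier → Set ℓ₂
  UnitInterval x = 0# ≤ x × x ≤ 1#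

  -- A price set is an injective enumeration, and a demand function is given
  -- on the indices of the prices.

  record Instance : Set (c ⊔ ℓ₁ ⊔ ℓ₂) where
    field
      N M S    : ℕ
      1≤N      : 1 ℕ.≤ N
      1≤M      : 1 ℕ.≤ M
      nᶜ nˢ nᵃ : ℕ
      Ωᶜ       : Fin nᶜ → Carrier
      Ωˢ       : Fin nˢ → Carrier
      Ωᵃ       : Fin nᵃ → Carrier
      αᶜ       : Fin N → Fin nᶜ → Carrier
      αˢ       : Fin M → Fin nˢ → Carrier
      β        : Fin M → Fin nˢ → Carrier
      β′       : Fin M → Fin nᵃ → Carrier

      Ωᶜ-injective   : Injective _≡_ _≈_ Ωᶜ
      Ωˢ-injective   : Injective _≡_ _≈_ Ωˢ
      Ωᵃ-injective   : Injective _≡_ _≈_ Ωᵃ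
      Ωᶜ-nonNegative : ∀ i → 0# ≤ Ωᶜ i
      Ωˢ-nonNegative : ∀ i → 0# ≤ Ωˢ i
      Ωᵃ-nonNegative : ∀ i → 0# ≤ Ωᵃ i
      αᶜ-unit        : ∀ n i → UnitInterval (αᶜ n i)
      αˢ-unit        : ∀ m i → UnitInterval (αˢ m i)
      β-unit         : ∀ m i → UnitInterval (β m i)
      β′-unit        : ∀ m i → UnitInterval (β′ m i)

    -- Prices are nonnegative, so the seed 0# does not affect the maximum.

    p̂ : Carrier
    p̂ = Extrema.max totalOrder 0# (List.tabulate Ωᶜ List.++ List.tabulate Ωˢ)

  𝟙 : Bool → Carrier
  𝟙 true  = 1#
  𝟙 false = 0#

  module _ (inst : Instance) where

    open Instance inst

    record Policy : Set where
      field
        pᶜ : Fin N → Fin nᶜ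
        pˢ : Fin M → Fin nˢ
        p′ : Fin M → Fin nᵃ
        I  : Subset M

    Feasible : Policy → Set (ℓ₁ ⊔ ℓ₂)
    Feasible π = ∣ I ∣ ℕ.≤ S × (∀ m → Ωᵃ (p′ m) < Ωˢ (pˢ m))
      where open Policy π

    V : Policy → Carrier
    V π =
      sum (λ n → αᶜ n (pᶜ n) * Ωᶜ (pᶜ n))
      + sum (λ m → αˢ m (pˢ m) * Ωˢ (pˢ m))
      + sum (λ n → αᶜ n (pᶜ n)) *
        sum (λ m → 𝟙 (lookup I m) * β′ m (p′ m) * Ωᵃ (p′ m)
                   + (1# - 𝟙 (lookup I m)) * β m (pˢ m) * Ωˢ (pˢ m))
      where open Policy π

    IsOptimal : Policy → Set (ℓ₁ ⊔ ℓ₂)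
    IsOptimal π = Feasible π × (∀ π′ → Feasible π′ → V π′ ≤ V π)

  -- Elementary operations on scalars, one step each.

  infixl 6 _+ᵗ_ _-ᵗ_
  infixl 7 _*ᵗ_
  infix  4 _≤ᵗ_ _<ᵗ_

  _+ᵗ_ _-ᵗ_ _*ᵗ_ : Carrier → Carrier → Timed Carrier
  x +ᵗ y = step (x + y)
  x -ᵗ y = step (x - y)
  x *ᵗ y = step (x * y)

  _≤ᵗ_ _<ᵗ_ : Carrier → Carrier → Timed Bool
  x ≤ᵗ y = step (does (x ≤? y))
  x <ᵗ y = step (not (does (y ≤? x)))

  sumᵗ : ∀ {n} → Vec Carrier n → Timed Carrier
  sumᵗ []       = return 0#
  sumᵗ (x ∷ xs) = do
    s ← sumᵗ xs
    x +ᵗ s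

  -- A maximiser together with the maximum; the first one wins ties.

  argmaxᵗ : (A → Timed Carrier) → List⁺ A → Timed (A × Carrier)
  argmaxᵗ {A = A} f (x ∷ xs) = go x xs
    where
    go : A → List A → Timed (A × Carrier)
    go x [] = do
      v ← f x
      return (x , v)
    go x (y ∷ ys) = do
      v       ← f x
      (z , w) ← go y ys
      b       ← w ≤ᵗ v
      return (if b then (x , v) else (z , w))

  -- Insertion sort in descending order of keys; stable.

  insertᵗ : (A → Carrier) → A → List A → Timed (List A)
  insertᵗ key x [] = step (x ∷ [])
  insertᵗ key x (y ∷ ys) = do
    false ← key y ≤ᵗ key x
      where true → step (x ∷ y ∷ ys)
    zs ← insertᵗ key x ys
    step (y ∷ zs)

  sortᵗ : (A → Carrier) → List A → Timed (List A)
  sortᵗ key []       = return []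
  sortᵗ key (x ∷ xs) = do
    ys ← sortᵗ key xs
    insertᵗ key x ys

  module Algorithm (inst : Instance) (K : ℕ) where

    open Instance inst

    -- The state γ = j / K is represented by j.

    gridᵗ : ℕ → Timed Carrier
    gridᵗ j = do
      r ← step (⟨ K ⟩ ⁻¹)
      ⟨ j ⟩ *ᵗ r

    -- The k for which k / K is nearest to x, for x in the unit interval; the
    -- smaller k wins ties.

    roundᵗ : Carrier → Timed (Fin (suc K))
    roundᵗ x = do
      (k , _) ← argmaxᵗ -distanceᵗ (zero ∷ List.tabulate suc)
      return k
      where
      -distanceᵗ : Fin (suc K) → Timed Carrier
      -distanceᵗ k = do
        g    ← gridᵗ (Fin.toℕ k)
        d    ← x -ᵗ g
        true ← 0# ≤ᵗ d
          where false → return d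
        0# -ᵗ d

    Rounding : Set
    Rounding = Vec (Vec (Fin (suc K)) nᶜ) N

    advance : ∀ {n} → Fin (suc K) → Fin (suc (n ℕ.* K)) → Fin (suc (suc n ℕ.* K))
    advance k j = fromℕ< (s≤s (ℕ.+-mono-≤ (Fin.toℕ≤pred[n] k) (Fin.toℕ≤pred[n] j)))

    record SupportDecision : Set c where
      constructor decision
      field
        prices   : Vec (Fin nˢ × Fin nᵃ) M
        discount : Subset M
        revenue  : Carrier

    open SupportDecision

    module _ (Sˢ : List⁺ (Fin nˢ)) (Sᵖ : List⁺ (Fin nˢ × Fin nᵃ)) where

      -- Without a discount the add-on price plays no role in the revenue.  It
      -- is then set to some price below p if there is one.

      belowᵗ : Fin nˢ → Timed (Fin nᵃ)
      belowᵗ p = findᵗ (λ p′ → Ωᵃ p′ <ᵗ Ωˢ p) (proj₂ (List⁺.head Sᵖ)) (allFin nᵃ)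

      supportᵗ : ℕ → Timed SupportDecision
      supportᵗ j = do
        γ      ← gridᵗ j
        r      ← tabulateᵗ (λ m → argmaxᵗ (regularᵗ γ m) Sˢ)
        r′     ← tabulateᵗ (λ m → argmaxᵗ (discountedᵗ γ m) Sᵖ)
        gain   ← tabulateᵗ (λ m → proj₂ (lookup r′ m) -ᵗ proj₂ (lookup r m))
        sorted ← sortᵗ (lookup gain) (allFin M)
        I      ← tabulateᵗ (λ m → do
                   positive ← 0# <ᵗ lookup gain m
                   first    ← amongFirstᵗ S m sorted
                   step (positive ∧ first))
        prices ← tabulateᵗ (λ m → chooseᵗ (lookup I m) (lookup r m) (lookup r′ m))
        terms  ← tabulateᵗ (λ m → do
                   x ← 𝟙 (lookup I m) *ᵗ lookup gain m
                   proj₂ (lookup r m) +ᵗ x)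
        R      ← sumᵗ terms
        return (decision prices I R)
        where
        regularᵗ : Carrier → Fin M → Fin nˢ → Timed Carrier
        regularᵗ γ m p = do
          x ← αˢ m p *ᵗ Ωˢ p
          y ← γ *ᵗ β m p
          z ← y *ᵗ Ωˢ p
          x +ᵗ z

        discountedᵗ : Carrier → Fin M → Fin nˢ × Fin nᵃ → Timed Carrier
        discountedᵗ γ m (p , p′) = do
          x ← αˢ m p *ᵗ Ωˢ p
          y ← γ *ᵗ β′ m p′
          z ← y *ᵗ Ωᵃ p′
          x +ᵗ z

        chooseᵗ : Bool → Fin nˢ × Carrier → (Fin nˢ × Fin nᵃ) × Carrier →
                  Timed (Fin nˢ × Fin nᵃ)
        chooseᵗ true  _       (pp′ , _) = step pp′
        chooseᵗ false (p , _) _         = do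
          p′ ← belowᵗ p
          step (p , p′)

    -- After the first n core products γ is in {0, …, nK/K}, so the value table
    -- of stage n has nK + 1 cells.  Given that table, the recursion computes the
    -- tables of the earlier stages, and on the way back it retrieves the state
    -- reached at stage n from γ = 0 along with the decisions leading to it.  The
    -- argument ι embeds the first n core products in all of them.

    backwardᵗ : List⁺ (Fin nᶜ) → Rounding → ∀ n → (Fin n → Fin N) →
                (Fin (suc (n ℕ.* K)) → Carrier) →
                Timed (Fin (suc (n ℕ.* K)) × Vec (Fin nᶜ) n)
    backwardᵗ Sᶜ α̂ zero    ι next = return (zero , [])
    backwardᵗ Sᶜ α̂ (suc n) ι next = do
      table    ← tabulateᵗ (λ j → argmaxᵗ (valueᵗ j) Sᶜ)
      (j , ps) ← backwardᵗ Sᶜ α̂ n (ι ∘ inject₁) (proj₂ ∘ lookup table)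
      p        ← step (proj₁ (lookup table j))
      step (advance {n} (lookup (lookup α̂ product) p) j , ps ∷ʳ p)
      where
      product : Fin N
      product = ι (fromℕ n)

      valueᵗ : Fin (suc (n ℕ.* K)) → Fin nᶜ → Timed Carrier
      valueᵗ j p = do
        x ← αᶜ product p *ᵗ Ωᶜ p
        y ← step (next (advance {n} (lookup (lookup α̂ product) p) j))
        x +ᵗ y

    solveᵗ : List⁺ (Fin nᶜ) → List⁺ (Fin nˢ) → List⁺ (Fin nˢ × Fin nᵃ) →
             Timed (Policy inst)
    solveᵗ Sᶜ Sˢ Sᵖ = do
      support  ← tabulateᵗ {n = suc (N ℕ.* K)} (supportᵗ Sˢ Sᵖ ∘ Fin.toℕ)
      α̂        ← tabulateᵗ (λ n → tabulateᵗ (roundᵗ ∘ αᶜ n))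
      (j , ps) ← backwardᵗ Sᶜ α̂ N id (revenue ∘ lookup support)
      let d = lookup support j
      return (record
        { pᶜ = lookup ps
        ; pˢ = proj₁ ∘ lookup (prices d)
        ; p′ = proj₂ ∘ lookup (prices d)
        ; I  = discount d
        })

    -- The maxima range over nonempty sets precisely when there are a core price
    -- and prices p′ < p; otherwise no policy is feasible.

    runᵗ : Timed (Maybe (Policy inst))
    runᵗ = do
      pairs ← filterᵗ (λ (p , p′) → Ωᵃ p′ <ᵗ Ωˢ p)
                      (cartesianProduct (allFin nˢ) (allFin nᵃ))
      dispatch (allFin nᶜ) (allFin nˢ) pairs
      where
      dispatch : List (Fin nᶜ) → List (Fin nˢ) → List (Fin nˢ × Fin nᵃ) →
                 Timed (Maybe (Policy inst))
      dispatch (x ∷ xs) (y ∷ ys) (z ∷ zs) = do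
        π ← solveᵗ (x ∷ xs) (y ∷ ys) (z ∷ zs)
        return (just π)
      dispatch _ _ _ = step nothing

  discretizedDP : (inst : Instance) → ℕ → Timed (Maybe (Policy inst))
  discretizedDP inst K = Algorithm.runᵗ inst K

{-# OPTIONS --safe #-}
module Submission where

-- Rounding a unit-interval number to the nearest multiple of 1/K moves it by at most
-- 1/(2K), so for every choice of core prices the total core demand moves by at most
-- N/(2K), and the value of a policy, whose dependence on the total core demand is
-- linear with a slope in [0, M p̂], moves by at most N M p̂/(2K).  The dynamic program is
-- exact once the total core demand is rounded: backward induction optimises the core
-- prices, and for a fixed total core demand the supportive products only interact
-- through the number of discounts, so that giving them to the S largest positive gains
-- is optimal.  Comparing OPT and ALG through the rounded problem costs
-- N M p̂/K ≤ ε v* in total.  All tables have O(N K) cells, so the number of steps is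
-- linear in K ≤ 1 + p̂ M N/(v* ε).

-- The regular revenue of a supportive product is maximised over all of `Ωˢ`, so a product without a
-- discount may receive a price with no add-on price below it. The guarantee is therefore kept apart
-- from feasibility: `p′ < p` is shown where a discount is given, and everywhere once each
-- supportive price has an add-on price below it. The first suffices for the error bound, because an
-- add-on price without a discount earns nothing. Demands are rounded before they are summed, so the
-- state of the dynamic program is an exact sum of grid points, and the only errors are one per core
-- product. They are incurred for the core prices of OPT and again for those of ALG. To avoid
-- dividing by two, the rounding inequalities are kept in doubled form and halved once, when the two
-- values are compared. The parameter K contains the ratio of `p̂` to `v*`, which is not a function
-- of the problem size. It is split off as a separate factor of the running time, and the polynomial
-- accounts for the rest.

open import Defs
open import Algebra.Bundles using (CommutativeMonoid)
import Algebra.Definitions.RawMonoid as RawMonoidDefs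
import Algebra.Properties.CommutativeSemigroup as CommutativeSemigroup
import Algebra.Properties.Ring
import Algebra.Properties.Semiring.Mult
import Algebra.Properties.Semiring.Sum
import Algebra.Solver.Ring.NaturalCoefficients.Default
open import Data.Bool.Base using (Bool; true; false; not; _∧_; if_then_else_)
open import Data.Fin.Base as Fin using (Fin; zero; suc; inject₁; fromℕ; fromℕ<; toℕ)
open import Data.Fin.Patterns using (0F; 1F; 2F; 3F; 4F; 5F)
import Data.Fin.Properties as Fin
open import Data.Fin.Subset using (Subset; ∣_∣; _∈_)
open import Data.List.Base as List using (List; []; _∷_; length; allFin; cartesianProduct)
import Data.List.Extrema as Extrema
open import Data.List.Membership.Propositional using () renaming (_∈_ to _∈ˡ_)
open import Data.List.Membership.Propositional.Properties
  using (∈-allFin; ∈-cartesianProduct⁺; ∈-tabulate⁺; ∈-++⁺ʳ)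
open import Data.List.NonEmpty.Base using (List⁺; _∷_)
import Data.List.Properties as List
open import Data.List.Relation.Binary.Permutation.Propositional as Perm
  using (_↭_; prep; swap; ↭-refl; ↭-sym)
open import Data.List.Relation.Binary.Permutation.Propositional.Properties using (All-resp-↭; ↭-length)
import Data.List.Relation.Binary.Permutation.Setoid.Properties as Permₛ
open import Data.List.Relation.Unary.All as All using (All; []; _∷_)
open import Data.List.Relation.Unary.AllPairs using (AllPairs; []; _∷_)
open import Data.List.Relation.Unary.Any using (here; there)
open import Data.List.Relation.Unary.Unique.Propositional using (Unique)
open import Data.List.Relation.Unary.Unique.Propositional.Properties using (allFin⁺)
open import Data.Maybe.Base using (just)
open import Data.Nat.Base as ℕ using (ℕ; zero; suc; z≤n; s≤s)
import Data.Nat.Properties as ℕ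
open import Data.Nat.Solver using (module +-*-Solver)
open import Data.Product.Base using (_×_; _,_; proj₁; proj₂; ∃-syntax; Σ-syntax; ∃₂)
open import Data.Sum.Base using (inj₁; inj₂)
open import Data.Vec.Base as Vec using (Vec; []; _∷_; lookup; _∷ʳ_)
open import Data.Vec.Properties using ([]=⇒lookup)
open import Function.Base using (_∘_; id)
open import Relation.Binary.Bundles using (DecTotalOrder)
import Relation.Binary.Construct.NonStrictToStrict as NonStrictToStrict
open import Relation.Binary.PropositionalEquality as ≡ using (_≡_; _≢_)
import Relation.Binary.Reasoning.PartialOrder
open import Relation.Nullary.Decidable.Core using (yes; no; does)
open import Relation.Nullary.Negation.Core using (¬_; contradiction)

-- Ordered fields

-- Steps are counted in ℕ, but the theorem evaluates its polynomial at scalars. The bound is proved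
-- for this evaluation and transported by `⟨⟦⟧⟩≤⟦⟧`.
⟦_⟧ℕ : ∀ {n} → Poly n → (Fin n → ℕ) → ℕ
⟦ con k ⟧ℕ  ks = k
⟦ var i ⟧ℕ  ks = ks i
⟦ p :+ q ⟧ℕ ks = ⟦ p ⟧ℕ ks ℕ.+ ⟦ q ⟧ℕ ks
⟦ p :* q ⟧ℕ ks = ⟦ p ⟧ℕ ks ℕ.* ⟦ q ⟧ℕ ks

module OrderedField {c ℓ₁ ℓ₂} (F : ArchimedeanOrderedField c ℓ₁ ℓ₂) where
  open ArchimedeanOrderedField F public
  open AddOn F public using (⟦_⟧; ⌈_⌉; UnitInterval)
  open DecTotalOrder decTotalOrder public using (poset; total; antisym)
    renaming (refl to ≤-refl; trans to ≤-trans; reflexive to ≤-reflexive)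
  open Algebra.Properties.Ring ring public using (-‿distribˡ-*; -0#≈0#; -‿involutive)
  open Algebra.Properties.Semiring.Mult semiring public using (×-homo-+; ×1-homo-*)
  open Algebra.Properties.Semiring.Sum semiring public
    using (sum-cong-≋; sum-init-last; ∑-distrib-+; *-distribˡ-sum)
  open Algebra.Solver.Ring.NaturalCoefficients.Default commutativeSemiring public
    using (solve; _:=_; con) renaming (_:+_ to _⊕_; _:*_ to _⊗_)
  module ≤-Reasoning = Relation.Binary.Reasoning.PartialOrder poset

  +-monoˡ-≤ : ∀ x {y z} → y ≤ z → y + x ≤ z + x
  +-monoˡ-≤ x {y} {z} y≤z = begin
    y + x ≈⟨ +-comm y x ⟩
    x + y ≤⟨ +-monoʳ-≤ x y≤z ⟩
    x + z ≈⟨ +-comm x z ⟩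
    z + x ∎
    where open ≤-Reasoning

  +-mono-≤ : ∀ {x y u v} → x ≤ y → u ≤ v → x + u ≤ y + v
  +-mono-≤ x≤y u≤v = ≤-trans (+-monoˡ-≤ _ x≤y) (+-monoʳ-≤ _ u≤v)

  +-nonNegative : ∀ {x y} → 0# ≤ x → 0# ≤ y → 0# ≤ x + y
  +-nonNegative 0≤x 0≤y = ≤-trans (≤-reflexive (sym (+-identityˡ 0#))) (+-mono-≤ 0≤x 0≤y)

  x-y+y≈x : ∀ x y → (x - y) + y ≈ x
  x-y+y≈x x y = trans (+-assoc x (- y) y) (trans (+-congˡ (-‿inverseˡ y)) (+-identityʳ x))

  x+y-y≈x : ∀ x y → (x + y) - y ≈ x
  x+y-y≈x x y = trans (+-assoc x y (- y)) (trans (+-congˡ (-‿inverseʳ y)) (+-identityʳ x))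

  x+[y-x]≈y : ∀ x y → x + (y - x) ≈ y
  x+[y-x]≈y x y = trans (+-comm x (y - x)) (x-y+y≈x y x)

  x≤z+y⇒x-y≤z : ∀ {x y z} → x ≤ z + y → x - y ≤ z
  x≤z+y⇒x-y≤z {x} {y} {z} h = ≤-trans (+-monoˡ-≤ (- y) h) (≤-reflexive (x+y-y≈x z y))

  x-y≤z⇒x≤z+y : ∀ {x y z} → x - y ≤ z → x ≤ z + y
  x-y≤z⇒x≤z+y {x} {y} {z} h = ≤-trans (≤-reflexive (sym (x-y+y≈x x y))) (+-monoˡ-≤ y h)

  x≤y⇒0≤y-x : ∀ {x y} → x ≤ y → 0# ≤ y - x
  x≤y⇒0≤y-x {x} {y} x≤y = ≤-trans (≤-reflexive (sym (-‿inverseʳ x))) (+-monoˡ-≤ (- x) x≤y)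

  +-cancelʳ-≤ : ∀ z {x y} → x + z ≤ y + z → x ≤ y
  +-cancelʳ-≤ z {x} {y} h = ≤-trans (≤-reflexive (sym (x+y-y≈x x z))) (x≤z+y⇒x-y≤z h)

  *-monoˡ-≤ : ∀ {z} → 0# ≤ z → ∀ {x y} → x ≤ y → z * x ≤ z * y
  *-monoˡ-≤ {z} 0≤z {x} {y} x≤y = begin
    z * x                 ≈⟨ +-identityʳ (z * x) ⟨
    z * x + 0#            ≤⟨ +-monoʳ-≤ _ (*-nonNegative 0≤z (x≤y⇒0≤y-x x≤y)) ⟩
    z * x + z * (y - x)   ≈⟨ distribˡ z x (y - x) ⟨
    z * (x + (y - x))     ≈⟨ *-congˡ (x+[y-x]≈y x y) ⟩
    z * y                 ∎
    where open ≤-Reasoning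

  *-monoʳ-≤ : ∀ {z} → 0# ≤ z → ∀ {x y} → x ≤ y → x * z ≤ y * z
  *-monoʳ-≤ {z} 0≤z {x} {y} x≤y = begin
    x * z ≈⟨ *-comm x z ⟩
    z * x ≤⟨ *-monoˡ-≤ 0≤z x≤y ⟩
    z * y ≈⟨ *-comm z y ⟩
    y * z ∎
    where open ≤-Reasoning

  *-mono-≤ : ∀ {x y u v} → 0# ≤ y → 0# ≤ u → x ≤ y → u ≤ v → x * u ≤ y * v
  *-mono-≤ 0≤y 0≤u x≤y u≤v = ≤-trans (*-monoʳ-≤ 0≤u x≤y) (*-monoˡ-≤ 0≤y u≤v)

  -- The order axioms do not compare the two constants. If `1#` were below `0#`, its negative would
  -- be nonnegative, and so would the square of that negative, which is `1#`.
  0≤1 : 0# ≤ 1#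
  0≤1 with total 0# 1#
  ... | inj₁ h = h
  ... | inj₂ 1≤0 = begin
    0#            ≤⟨ *-nonNegative 0≤-1 0≤-1 ⟩
    - 1# * - 1#   ≈⟨ -‿distribˡ-* 1# (- 1#) ⟨
    - (1# * - 1#) ≈⟨ -‿cong (*-identityˡ (- 1#)) ⟩
    - (- 1#)      ≈⟨ -‿involutive 1# ⟩
    1#            ∎
    where
    open ≤-Reasoning
    0≤-1 : 0# ≤ - 1#
    0≤-1 = ≤-trans (x≤y⇒0≤y-x 1≤0) (≤-reflexive (+-identityˡ (- 1#)))

  <⇒≱ : ∀ {x y} → x < y → ¬ (y ≤ x)
  <⇒≱ = NonStrictToStrict.<⇒≱ _≈_ _≤_ antisym

  ≰⇒> : ∀ {x y} → ¬ (x ≤ y) → y < x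
  ≰⇒> = NonStrictToStrict.≰⇒> _≈_ _≤_ sym ≤-reflexive total

  <-≤-trans : ∀ {x y z} → x < y → y ≤ z → x < z
  <-≤-trans = NonStrictToStrict.<-≤-trans _≈_ _≤_ sym ≤-trans antisym (λ e h → ≤-trans h (≤-reflexive e))

  ≤-<-trans : ∀ {x y z} → x ≤ y → y < z → x < z
  ≤-<-trans = NonStrictToStrict.≤-<-trans _≈_ _≤_ ≤-trans antisym (λ e h → ≤-trans (≤-reflexive (sym e)) h)

  1≰0 : ¬ (1# ≤ 0#)
  1≰0 h = 0≉1 (antisym 0≤1 h)

  <⇒≉0 : ∀ {x} → 0# < x → x ≉ 0#
  <⇒≉0 (_ , 0≉x) x≈0 = 0≉x (sym x≈0)

  ⟨⟩-nonNegative : ∀ n → 0# ≤ ⟨ n ⟩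
  ⟨⟩-nonNegative zero    = ≤-refl
  ⟨⟩-nonNegative (suc n) = +-nonNegative 0≤1 (⟨⟩-nonNegative n)

  ⟨⟩-mono : ∀ {m n} → m ℕ.≤ n → ⟨ m ⟩ ≤ ⟨ n ⟩
  ⟨⟩-mono {n = n} z≤n = ⟨⟩-nonNegative n
  ⟨⟩-mono (s≤s m≤n)   = +-monoʳ-≤ 1# (⟨⟩-mono m≤n)

  0<⟨⟩ : ∀ {n} → 1 ℕ.≤ n → 0# < ⟨ n ⟩
  0<⟨⟩ 1≤n = <-≤-trans (0≤1 , 0≉1) (≤-trans (≤-reflexive (sym (+-identityʳ 1#))) (⟨⟩-mono 1≤n))

  *-positive : ∀ {x y} → 0# < x → 0# < y → 0# < x * y
  *-positive {x} {y} 0<x@(0≤x , _) 0<y@(0≤y , _) = *-nonNegative 0≤x 0≤y , λ 0≈xy → 0≉1 (begin-equality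
    0#                     ≈⟨ zeroˡ _ ⟨
    0# * (x ⁻¹ * y ⁻¹)     ≈⟨ *-congʳ 0≈xy ⟩
    x * y * (x ⁻¹ * y ⁻¹)  ≈⟨ solve 4 (λ x y u v → x ⊗ y ⊗ (u ⊗ v) := x ⊗ u ⊗ (y ⊗ v)) refl x y (x ⁻¹) (y ⁻¹) ⟩
    x * x ⁻¹ * (y * y ⁻¹)  ≈⟨ *-cong (*-inverseʳ (<⇒≉0 0<x)) (*-inverseʳ (<⇒≉0 0<y)) ⟩
    1# * 1#                ≈⟨ *-identityˡ 1# ⟩
    1#                     ∎)
    where open ≤-Reasoning

  ⁻¹-positive : ∀ {x} → 0# < x → 0# < x ⁻¹
  ⁻¹-positive {x} 0<x = ≰⇒> λ x⁻¹≤0 → 1≰0 (begin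
    1#       ≈⟨ *-inverseʳ (<⇒≉0 0<x) ⟨
    x * x ⁻¹ ≤⟨ *-monoˡ-≤ (proj₁ 0<x) x⁻¹≤0 ⟩
    x * 0#   ≈⟨ zeroʳ x ⟩
    0#       ∎)
    where open ≤-Reasoning

  x≤y*z⇒x*z⁻¹≤y : ∀ {x y z} → 0# < z → x ≤ y * z → x * z ⁻¹ ≤ y
  x≤y*z⇒x*z⁻¹≤y {x} {y} {z} 0<z h = begin
    x * z ⁻¹       ≤⟨ *-monoʳ-≤ (proj₁ (⁻¹-positive 0<z)) h ⟩
    y * z * z ⁻¹   ≈⟨ *-assoc y z (z ⁻¹) ⟩
    y * (z * z ⁻¹) ≈⟨ *-congˡ (*-inverseʳ (<⇒≉0 0<z)) ⟩
    y * 1#         ≈⟨ *-identityʳ y ⟩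
    y              ∎
    where open ≤-Reasoning

  x*z⁻¹≤y⇒x≤y*z : ∀ {x y z} → 0# < z → x * z ⁻¹ ≤ y → x ≤ y * z
  x*z⁻¹≤y⇒x≤y*z {x} {y} {z} 0<z h = begin
    x              ≈⟨ *-identityʳ x ⟨
    x * 1#         ≈⟨ *-congˡ (*-inverseʳ (<⇒≉0 0<z)) ⟨
    x * (z * z ⁻¹) ≈⟨ solve 3 (λ x z w → x ⊗ (z ⊗ w) := x ⊗ w ⊗ z) refl x z (z ⁻¹) ⟩
    x * z ⁻¹ * z   ≤⟨ *-monoʳ-≤ (proj₁ 0<z) h ⟩
    y * z          ∎
    where open ≤-Reasoning

  ⁻¹-distrib-* : ∀ {x y} → 0# < x → 0# < y → (x * y) ⁻¹ ≈ x ⁻¹ * y ⁻¹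
  ⁻¹-distrib-* {x} {y} 0<x 0<y = begin-equality
    (x * y) ⁻¹                            ≈⟨ trans (*-congʳ (*-identityˡ 1#)) (*-identityˡ _) ⟨
    1# * 1# * (x * y) ⁻¹                  ≈⟨ *-congʳ (*-cong (*-inverseʳ (<⇒≉0 0<x)) (*-inverseʳ (<⇒≉0 0<y))) ⟨
    x * x ⁻¹ * (y * y ⁻¹) * (x * y) ⁻¹    ≈⟨ solve 5 (λ x y u v w → x ⊗ u ⊗ (y ⊗ v) ⊗ w := x ⊗ y ⊗ w ⊗ (u ⊗ v)) refl x y (x ⁻¹) (y ⁻¹) ((x * y) ⁻¹) ⟩
    x * y * (x * y) ⁻¹ * (x ⁻¹ * y ⁻¹)    ≈⟨ *-congʳ (*-inverseʳ (<⇒≉0 (*-positive 0<x 0<y))) ⟩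
    1# * (x ⁻¹ * y ⁻¹)                    ≈⟨ *-identityˡ _ ⟩
    x ⁻¹ * y ⁻¹                           ∎
    where open ≤-Reasoning

  -- Halving by cancellation: if `y ≤ x`, then `x + x ≤ y + y ≤ y + x`.
  x+x≤y+y⇒x≤y : ∀ {x y} → x + x ≤ y + y → x ≤ y
  x+x≤y+y⇒x≤y {x} {y} h with total x y
  ... | inj₁ x≤y = x≤y
  ... | inj₂ y≤x = +-cancelʳ-≤ x (≤-trans h (+-monoʳ-≤ y y≤x))

  sum-mono-≤ : ∀ {n} {f g : Fin n → Carrier} → (∀ i → f i ≤ g i) → sum f ≤ sum g
  sum-mono-≤ {zero}  f≤g = ≤-refl
  sum-mono-≤ {suc n} f≤g = +-mono-≤ (f≤g zero) (sum-mono-≤ (f≤g ∘ suc))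

  sum-nonNegative : ∀ {n} {f : Fin n → Carrier} → (∀ i → 0# ≤ f i) → 0# ≤ sum f
  sum-nonNegative {zero}  0≤f = ≤-refl
  sum-nonNegative {suc n} 0≤f = +-nonNegative (0≤f zero) (sum-nonNegative (0≤f ∘ suc))

  sum-≤ : ∀ {n} {f : Fin n → Carrier} b → (∀ i → f i ≤ b) → sum f ≤ ⟨ n ⟩ * b
  sum-≤ {zero}  b f≤b = ≤-reflexive (sym (zeroˡ b))
  sum-≤ {suc n} {f} b f≤b = begin
    f zero + sum (f ∘ suc) ≤⟨ +-mono-≤ (f≤b zero) (sum-≤ b (f≤b ∘ suc)) ⟩
    b + ⟨ n ⟩ * b          ≈⟨ +-congʳ (sym (*-identityˡ b)) ⟩
    1# * b + ⟨ n ⟩ * b     ≈⟨ sym (distribʳ b 1# _) ⟩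
    ⟨ suc n ⟩ * b          ∎
    where open ≤-Reasoning

  x≤⟨⌈x⌉⟩ : ∀ x → x ≤ ⟨ ⌈ x ⌉ ⟩
  x≤⟨⌈x⌉⟩ x = proj₁ (proj₂ (least (λ n → x ≤? ⟨ n ⟩) (archimedean x)))

  -- By minimality the predecessor of a nonzero ceiling fails to dominate `x`, so it lies below `x`.
  -- A zero ceiling is covered by nonnegativity.
  ⟨⌈x⌉⟩≤1+x : ∀ {x} → 0# ≤ x → ⟨ ⌈ x ⌉ ⟩ ≤ 1# + x
  ⟨⌈x⌉⟩≤1+x {x} 0≤x with least (λ n → x ≤? ⟨ n ⟩) (archimedean x)
  ... | zero  , _           = +-nonNegative 0≤1 0≤x
  ... | suc k , _ , minimal with total ⟨ k ⟩ x
  ...   | inj₁ k≤x = +-monoʳ-≤ 1# k≤x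
  ...   | inj₂ x≤k = contradiction x≤k (minimal (ℕ.n<1+n k))

  -- Natural coefficients make polynomials monotone on nonnegative arguments. Asking for an
  -- inequality between the arguments lets 0 stand in for `ε ⁻¹`, which need not be a natural
  -- number.
  ⟨⟦⟧⟩≤⟦⟧ : ∀ {n} (p : Poly n) {ks : Fin n → ℕ} {xs : Vec Carrier n} →
            (∀ i → ⟨ ks i ⟩ ≤ lookup xs i) → ⟨ ⟦ p ⟧ℕ ks ⟩ ≤ ⟦ p ⟧ xs
  ⟨⟦⟧⟩≤⟦⟧ (con k)  h = ≤-refl
  ⟨⟦⟧⟩≤⟦⟧ (var i)  h = h i
  ⟨⟦⟧⟩≤⟦⟧ (p :+ q) {ks} h = ≤-trans (≤-reflexive (×-homo-+ 1# (⟦ p ⟧ℕ ks) (⟦ q ⟧ℕ ks))) (+-mono-≤ (⟨⟦⟧⟩≤⟦⟧ p {ks} h) (⟨⟦⟧⟩≤⟦⟧ q {ks} h))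
  ⟨⟦⟧⟩≤⟦⟧ (p :* q) {ks} h =
    ≤-trans (≤-reflexive (×1-homo-* (⟦ p ⟧ℕ ks) (⟦ q ⟧ℕ ks)))
            (*-mono-≤ (≤-trans (⟨⟩-nonNegative (⟦ p ⟧ℕ ks)) (⟨⟦⟧⟩≤⟦⟧ p {ks} h)) (⟨⟩-nonNegative (⟦ q ⟧ℕ ks)) (⟨⟦⟧⟩≤⟦⟧ p {ks} h) (⟨⟦⟧⟩≤⟦⟧ q {ks} h))

-- Tables, sorting and the greedy choice of discounts

length-allFin : ∀ n → length (allFin n) ≡ n
length-allFin n = List.length-tabulate id

length-cartesianProduct : ∀ {a b} {A : Set a} {B : Set b} (xs : List A) (ys : List B) →
                          length (cartesianProduct xs ys) ≡ length xs ℕ.* length ys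
length-cartesianProduct []       ys = ≡.refl
length-cartesianProduct (x ∷ xs) ys = ≡.trans (List.length-++ (List.map (x ,_) ys))
  (≡.cong₂ ℕ._+_ (List.length-map (x ,_) ys) (length-cartesianProduct xs ys))

lookup-tabulateᵗ : ∀ {a} {A : Set a} {n} (f : Fin n → Timed A) i →
                   lookup (value (tabulateᵗ f)) i ≡ value (f i)
lookup-tabulateᵗ f zero    = ≡.refl
lookup-tabulateᵗ f (suc i) = lookup-tabulateᵗ (f ∘ suc) i

module _ {a} {A : Set a} (p : A → Timed Bool) where

  ∈-filterᵗ⁺ : ∀ {x xs} → x ∈ˡ xs → value (p x) ≡ true → x ∈ˡ value (filterᵗ p xs)
  ∈-filterᵗ⁺ {x} (here ≡.refl) px rewrite px = here ≡.refl
  ∈-filterᵗ⁺ {xs = y ∷ ys} (there x∈) px with value (p y)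
  ... | true  = there (∈-filterᵗ⁺ x∈ px)
  ... | false = ∈-filterᵗ⁺ x∈ px

  filterᵗ-All : ∀ xs → All (λ x → value (p x) ≡ true) (value (filterᵗ p xs))
  filterᵗ-All []       = []
  filterᵗ-All (x ∷ xs) with value (p x) in px
  ... | true  = px ∷ filterᵗ-All xs
  ... | false = filterᵗ-All xs

  findᵗ-satisfies : ∀ d {x xs} → x ∈ˡ xs → value (p x) ≡ true → value (p (value (findᵗ p d xs))) ≡ true
  findᵗ-satisfies d {xs = y ∷ ys} x∈ px with value (p y) in py
  ... | true = py
  findᵗ-satisfies d {xs = y ∷ ys} (there x∈) px    | false = findᵗ-satisfies d x∈ px
  findᵗ-satisfies d {xs = y ∷ ys} (here ≡.refl) px | false = contradiction (≡.trans (≡.sym py) px) λ ()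

-- Used in two monoids: ℕ, to count discounts, and the scalars, to add up gains. Invariance under
-- permutations moves both to the sorted list.
module ListSum {c ℓ} (CM : CommutativeMonoid c ℓ) where
  open CommutativeMonoid CM
  open CommutativeSemigroup commutativeSemigroup using (x∙yz≈y∙xz)
  open RawMonoidDefs rawMonoid using (sum)

  module _ {a} {A : Set a} where

    ∑ : (A → Carrier) → List A → Carrier
    ∑ f = List.foldr (λ x s → f x ∙ s) ε

    ∑-↭ : ∀ f {xs ys} → xs ↭ ys → ∑ f xs ≈ ∑ f ys
    ∑-↭ f Perm.refl        = refl
    ∑-↭ f (prep x p)       = ∙-congˡ (∑-↭ f p)
    ∑-↭ f (swap x y p)     = trans (x∙yz≈y∙xz _ _ _) (∙-congˡ (∙-congˡ (∑-↭ f p)))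
    ∑-↭ f (Perm.trans p q) = trans (∑-↭ f p) (∑-↭ f q)

    ∑-cong : ∀ {f g xs} → All (λ x → f x ≈ g x) xs → ∑ f xs ≈ ∑ g xs
    ∑-cong []       = refl
    ∑-cong (e ∷ es) = ∙-cong e (∑-cong es)

    ∑-tabulate : ∀ f {n} (g : Fin n → A) → ∑ f (List.tabulate g) ≡ sum (f ∘ g)
    ∑-tabulate f {zero}  g = ≡.refl
    ∑-tabulate f {suc n} g = ≡.cong (f (g zero) ∙_) (∑-tabulate f (g ∘ suc))

private
  module ℕ-Sum = ListSum ℕ.+-0-commutativeMonoid

bit : Bool → ℕ
bit b = if b then 1 else 0

count : ∀ {a} {A : Set a} → (A → Bool) → List A → ℕ
count J = ℕ-Sum.∑ (bit ∘ J)

∣∣≡count : ∀ {n} (J : Subset n) → ∣ J ∣ ≡ count (lookup J) (allFin n)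
∣∣≡count J = ≡.trans (go J) (≡.sym (ℕ-Sum.∑-tabulate (bit ∘ lookup J) id))
  where
  open RawMonoidDefs ℕ.+-0-rawMonoid using (sum)
  go : ∀ {n} (J : Subset n) → ∣ J ∣ ≡ sum (bit ∘ lookup J)
  go []          = ≡.refl
  go (true ∷ J)  = ≡.cong suc (go J)
  go (false ∷ J) = go J

amongFirstᵗ-here : ∀ {n} s (x : Fin n) xs → value (amongFirstᵗ (suc s) x (x ∷ xs)) ≡ true
amongFirstᵗ-here s x xs with x Fin.≟ x
... | yes _  = ≡.refl
... | no x≢x = contradiction ≡.refl x≢x

amongFirstᵗ-there : ∀ {n} s {x y : Fin n} xs → x ≢ y →
                    value (amongFirstᵗ (suc s) y (x ∷ xs)) ≡ value (amongFirstᵗ s y xs)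
amongFirstᵗ-there s {x} {y} xs x≢y with y Fin.≟ x
... | yes y≡x = contradiction (≡.sym y≡x) x≢y
... | no _    = ≡.refl

module Optimization {c ℓ₁ ℓ₂} (F : ArchimedeanOrderedField c ℓ₁ ℓ₂) where
  open OrderedField F
  open AddOn F using (𝟙; sumᵗ; argmaxᵗ; insertᵗ; sortᵗ; _<ᵗ_)
  open ListSum +-commutativeMonoid

  sumᵗ-tabulateᵗ : ∀ {n} (f : Fin n → Timed Carrier) →
                   value (sumᵗ (value (tabulateᵗ f))) ≡ sum (value ∘ f)
  sumᵗ-tabulateᵗ {zero}  f = ≡.refl
  sumᵗ-tabulateᵗ {suc n} f = ≡.cong (value (f zero) +_) (sumᵗ-tabulateᵗ (f ∘ suc))

  <ᵗ-true : ∀ {x y} → x < y → value (x <ᵗ y) ≡ true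
  <ᵗ-true {x} {y} x<y with y ≤? x
  ... | yes y≤x = contradiction y≤x (<⇒≱ x<y)
  ... | no _    = ≡.refl

  <ᵗ-true⁻ : ∀ {x y} → value (x <ᵗ y) ≡ true → x < y
  <ᵗ-true⁻ {x} {y} e with y ≤? x
  ... | no y≰x = ≰⇒> y≰x

  module _ {a} {A : Set a} (f : A → Timed Carrier) where

    private
      Attained : A × Carrier → Set c
      Attained (z , w) = w ≡ value (f z)

      -- One round of `argmaxᵗ`, whose recursion is a local function: on `x ∷ y ∷ ys` its value is
      -- `better x` of its value on `y ∷ ys`, by computation.
      better : A → A × Carrier → A × Carrier
      better x zw = if does (proj₂ zw ≤? value (f x)) then (x , value (f x)) else zw

      better-attained : ∀ x zw → Attained zw → Attained (better x zw)
      better-attained x zw e with does (proj₂ zw ≤? value (f x))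
      ... | true  = ≡.refl
      ... | false = e

      better-∈ : ∀ x zw xs → proj₁ zw ∈ˡ xs → proj₁ (better x zw) ∈ˡ x ∷ xs
      better-∈ x zw xs z∈xs with does (proj₂ zw ≤? value (f x))
      ... | true  = here ≡.refl
      ... | false = there z∈xs

      better-≥ : ∀ x zw → value (f x) ≤ proj₂ (better x zw) × proj₂ zw ≤ proj₂ (better x zw)
      better-≥ x zw with proj₂ zw ≤? value (f x)
      ... | yes w≤v = ≤-refl , w≤v
      ... | no w≰v  = proj₁ (≰⇒> w≰v) , ≤-refl

    argmaxᵗ-attains : ∀ x xs → let (z , w) = value (argmaxᵗ f (x ∷ xs)) in w ≡ value (f z)
    argmaxᵗ-attains x []       = ≡.refl
    argmaxᵗ-attains x (y ∷ ys) = better-attained x (value (argmaxᵗ f (y ∷ ys))) (argmaxᵗ-attains y ys)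

    argmaxᵗ-∈ : ∀ x xs → proj₁ (value (argmaxᵗ f (x ∷ xs))) ∈ˡ x ∷ xs
    argmaxᵗ-∈ x []       = here ≡.refl
    argmaxᵗ-∈ x (y ∷ ys) = better-∈ x (value (argmaxᵗ f (y ∷ ys))) (y ∷ ys) (argmaxᵗ-∈ y ys)

    argmaxᵗ-max : ∀ x xs {y} → y ∈ˡ x ∷ xs → value (f y) ≤ proj₂ (value (argmaxᵗ f (x ∷ xs)))
    argmaxᵗ-max x []       (here ≡.refl) = ≤-refl
    argmaxᵗ-max x (y ∷ ys) (here ≡.refl) = proj₁ (better-≥ x (value (argmaxᵗ f (y ∷ ys))))
    argmaxᵗ-max x (y ∷ ys) (there z∈)    =
      ≤-trans (argmaxᵗ-max y ys z∈) (proj₂ (better-≥ x (value (argmaxᵗ f (y ∷ ys)))))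

  module _ {a} {A : Set a} (key : A → Carrier) where

    Descending : List A → Set _
    Descending = AllPairs (λ x y → key y ≤ key x)

    insertᵗ-↭ : ∀ x xs → value (insertᵗ key x xs) ↭ x ∷ xs
    insertᵗ-↭ x []       = ↭-refl
    insertᵗ-↭ x (y ∷ ys) with does (key y ≤? key x)
    ... | true  = ↭-refl
    ... | false = Perm.trans (prep y (insertᵗ-↭ x ys)) (swap y x ↭-refl)

    sortᵗ-↭ : ∀ xs → value (sortᵗ key xs) ↭ xs
    sortᵗ-↭ []       = ↭-refl
    sortᵗ-↭ (x ∷ xs) = Perm.trans (insertᵗ-↭ x _) (prep x (sortᵗ-↭ xs))

    insertᵗ-descending : ∀ x {xs} → Descending xs → Descending (value (insertᵗ key x xs))
    insertᵗ-descending x []                    = [] ∷ []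
    insertᵗ-descending x {y ∷ ys} (y≥ys ∷ ys↘) with key y ≤? key x
    ... | yes y≤x = (y≤x ∷ All.map (λ z≤y → ≤-trans z≤y y≤x) y≥ys) ∷ y≥ys ∷ ys↘
    ... | no y≰x  = All-resp-↭ (↭-sym (insertᵗ-↭ x ys)) (proj₁ (≰⇒> y≰x) ∷ y≥ys) ∷ insertᵗ-descending x ys↘

    sortᵗ-descending : ∀ xs → Descending (value (sortᵗ key xs))
    sortᵗ-descending []       = []
    sortᵗ-descending (x ∷ xs) = insertᵗ-descending x (sortᵗ-descending xs)

    positive : A → Bool
    positive x = value (0# <ᵗ key x)

    -- The positive part of the key, written with the indicator that the algorithm computes when it
    -- tests whether a gain is positive.
    _⁺ : A → Carrier
    x ⁺ = 𝟙 (positive x) * key x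

    0≤x⁺ : ∀ x → 0# ≤ x ⁺
    0≤x⁺ x with key x ≤? 0#
    ... | yes _  = ≤-reflexive (sym (zeroˡ _))
    ... | no x≰0 = ≤-trans (proj₁ (≰⇒> x≰0)) (≤-reflexive (sym (*-identityˡ _)))

    x≤x⁺ : ∀ x → key x ≤ x ⁺
    x≤x⁺ x with key x ≤? 0#
    ... | yes x≤0 = ≤-trans x≤0 (≤-reflexive (sym (zeroˡ _)))
    ... | no _    = ≤-reflexive (sym (*-identityˡ _))

    ⁺-mono : ∀ {x y} → key x ≤ key y → x ⁺ ≤ y ⁺
    ⁺-mono {x} {y} x≤y with key x ≤? 0#
    ... | yes _ = ≤-trans (≤-reflexive (zeroˡ _)) (0≤x⁺ y)
    ... | no _  = ≤-trans (≤-reflexive (*-identityˡ _)) (≤-trans x≤y (x≤x⁺ y))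

    -- On a descending list this is the largest total of keys over at most `s` entries. It is the
    -- yardstick for both the greedy choice and its competitors.
    top : ℕ → List A → Carrier
    top zero    xs       = 0#
    top (suc s) []       = 0#
    top (suc s) (x ∷ xs) = x ⁺ + top s xs

    -- Exchange argument: moving every selected entry one place towards the head does not decrease
    -- its positive part.
    top-exchange : ∀ s {x xs} → Descending (x ∷ xs) → top (suc s) xs ≤ x ⁺ + top s xs
    top-exchange zero    {x} {[]}     _                   = +-nonNegative (0≤x⁺ x) ≤-refl
    top-exchange (suc s) {x} {[]}     _                   = +-nonNegative (0≤x⁺ x) ≤-refl
    top-exchange zero    {x} {y ∷ ys} ((y≤x ∷ _) ∷ _)     = +-monoˡ-≤ 0# (⁺-mono y≤x)
    top-exchange (suc s) {x} {y ∷ ys} ((y≤x ∷ _) ∷ ys↘) = +-mono-≤ (⁺-mono y≤x) (top-exchange s ys↘)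

    -- Selecting the head spends one unit of the budget and earns at most its positive part.
    -- Declining it leaves the whole budget for the tail, and `top-exchange` shows that nothing is
    -- won by this.
    top-max : ∀ (J : A → Bool) s {xs} → Descending xs → count J xs ℕ.≤ s →
              ∑ (λ x → 𝟙 (J x) * key x) xs ≤ top s xs
    top-max J zero    []                   _ = ≤-refl
    top-max J (suc s) []                   _ = ≤-refl
    top-max J s       {x ∷ xs} (x≥xs ∷ xs↘) |J|≤s with J x
    top-max J (suc s) {x ∷ xs} (x≥xs ∷ xs↘) (s≤s |J|≤s) | true =
      +-mono-≤ (≤-trans (≤-reflexive (*-identityˡ _)) (x≤x⁺ x)) (top-max J s xs↘ |J|≤s)
    top-max J zero    {x ∷ xs} (x≥xs ∷ xs↘) |J|≤s | false =
      ≤-trans (≤-reflexive (trans (+-congʳ (zeroˡ _)) (+-identityˡ _))) (top-max J zero xs↘ |J|≤s)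
    top-max J (suc s) {x ∷ xs} (x≥xs ∷ xs↘) |J|≤s | false =
      ≤-trans (≤-reflexive (trans (+-congʳ (zeroˡ _)) (+-identityˡ _)))
              (≤-trans (top-max J (suc s) xs↘ |J|≤s) (top-exchange s (x≥xs ∷ xs↘)))

  module _ {n} (key : Fin n → Carrier) where

    chosen : ℕ → List (Fin n) → Fin n → Bool
    chosen s xs i = positive key i ∧ value (amongFirstᵗ s i xs)

    -- The head occupies one of the first places whether or not its key is positive, so the tail is
    -- left with a budget smaller by one. Distinctness ensures that no later entry is mistaken for
    -- the head.
    chosen-there : ∀ s {x xs} → All (x ≢_) xs → All (λ y → chosen (suc s) (x ∷ xs) y ≡ chosen s xs y) xs
    chosen-there s {x} {xs} = All.map λ {y} x≢y → ≡.cong (positive key y ∧_) (amongFirstᵗ-there s xs x≢y)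

    chosen-zero : ∀ xs i → chosen zero xs i ≡ false
    chosen-zero xs i with positive key i
    ... | true  = ≡.refl
    ... | false = ≡.refl

    chosen-here : ∀ s x xs → chosen (suc s) (x ∷ xs) x ≡ positive key x
    chosen-here s x xs rewrite amongFirstᵗ-here s x xs with positive key x
    ... | true  = ≡.refl
    ... | false = ≡.refl

    count-false : ∀ {J : Fin n → Bool} → (∀ i → J i ≡ false) → ∀ xs → count J xs ≡ 0
    count-false J≡f []       = ≡.refl
    count-false J≡f (x ∷ xs) rewrite J≡f x = count-false J≡f xs

    count-chosen : ∀ s {xs} → Unique xs → count (chosen s xs) xs ℕ.≤ s
    count-chosen zero    {xs} _            = ℕ.≤-reflexive (count-false (chosen-zero xs) xs)
    count-chosen (suc s) []                = z≤n
    count-chosen (suc s) {x ∷ xs} (x∉ ∷ u) = ℕ.+-mono-≤ (bit≤1 _)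
      (ℕ.≤-trans (ℕ.≤-reflexive (ℕ-Sum.∑-cong (All.map (≡.cong bit) (chosen-there s x∉)))) (count-chosen s u))
      where
      bit≤1 : ∀ b → bit b ℕ.≤ 1
      bit≤1 true  = ℕ.≤-refl
      bit≤1 false = z≤n

    ∑-chosen : ∀ s {xs} → Unique xs → ∑ (λ i → 𝟙 (chosen s xs i) * key i) xs ≈ top key s xs
    ∑-chosen zero    {xs} _ = trans
      (∑-cong (All.universal (λ i → trans (*-congʳ (reflexive (≡.cong 𝟙 (chosen-zero xs i)))) (zeroˡ (key i))) xs)) (∑-zero xs)
      where
      ∑-zero : ∀ (xs : List (Fin n)) → ∑ (λ _ → 0#) xs ≈ 0#
      ∑-zero []       = refl
      ∑-zero (x ∷ xs) = trans (+-identityˡ _) (∑-zero xs)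
    ∑-chosen (suc s) []                = refl
    ∑-chosen (suc s) {x ∷ xs} (x∉ ∷ u) = +-cong
      (*-congʳ (reflexive (≡.cong 𝟙 (chosen-here s x xs))))
      (trans (∑-cong (All.map (λ e → *-congʳ (reflexive (≡.cong 𝟙 e))) (chosen-there s x∉))) (∑-chosen s u))

    private
      sorted : List (Fin n)
      sorted = value (sortᵗ key (allFin n))

      sorted↭ : sorted ↭ allFin n
      sorted↭ = sortᵗ-↭ key (allFin n)

      sorted-unique : Unique sorted
      sorted-unique = Permₛ.Unique-resp-↭ (≡.setoid (Fin n)) (Perm.↭⇒↭ₛ (↭-sym sorted↭)) (allFin⁺ n)

      count≡count-sorted : ∀ J → count J (allFin n) ≡ count J sorted
      count≡count-sorted J = ≡.sym (ℕ-Sum.∑-↭ (bit ∘ J) sorted↭)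

      sum≈∑-sorted : ∀ f → sum f ≈ ∑ f sorted
      sum≈∑-sorted f = trans (reflexive (≡.sym (∑-tabulate f id))) (sym (∑-↭ f sorted↭))

    greedy-size : ∀ s → (I : Subset n) → (∀ i → lookup I i ≡ chosen s sorted i) → ∣ I ∣ ℕ.≤ s
    greedy-size s I I≡ = begin
      ∣ I ∣                            ≡⟨ ∣∣≡count I ⟩
      count (lookup I) (allFin n)      ≡⟨ count≡count-sorted (lookup I) ⟩
      count (lookup I) sorted          ≡⟨ ℕ-Sum.∑-cong (All.universal (≡.cong bit ∘ I≡) sorted) ⟩
      count (chosen s sorted) sorted   ≤⟨ count-chosen s sorted-unique ⟩
      s                                ∎
      where open ℕ.≤-Reasoning

    -- On the sorted list `top` bounds the total of every admissible set and is exactly the total of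
    -- the greedy one.
    greedy-optimal : ∀ s (I : Subset n) → (∀ i → lookup I i ≡ chosen s sorted i) →
                     ∀ (J : Subset n) → ∣ J ∣ ℕ.≤ s →
                     sum (λ i → 𝟙 (lookup J i) * key i) ≤ sum (λ i → 𝟙 (lookup I i) * key i)
    greedy-optimal s I I≡ J |J|≤s = begin
      sum (λ i → 𝟙 (lookup J i) * key i)                ≈⟨ sum≈∑-sorted _ ⟩
      ∑ (λ i → 𝟙 (lookup J i) * key i) sorted           ≤⟨ top-max key (lookup J) s (sortᵗ-descending key (allFin n)) |J|≤s′ ⟩
      top key s sorted                                  ≈⟨ ∑-chosen s sorted-unique ⟨
      ∑ (λ i → 𝟙 (chosen s sorted i) * key i) sorted    ≈⟨ ∑-cong (All.universal (λ i → *-congʳ (reflexive (≡.cong 𝟙 (I≡ i)))) sorted) ⟨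
      ∑ (λ i → 𝟙 (lookup I i) * key i) sorted           ≈⟨ sum≈∑-sorted _ ⟨
      sum (λ i → 𝟙 (lookup I i) * key i)                ∎
      where
      open ≤-Reasoning
      |J|≤s′ : count (lookup J) sorted ℕ.≤ s
      |J|≤s′ = ≡.subst (ℕ._≤ s) (≡.trans (∣∣≡count J) (count≡count-sorted (lookup J))) |J|≤s

-- Local definitions of the algorithm

module Components {c ℓ₁ ℓ₂} (F : ArchimedeanOrderedField c ℓ₁ ℓ₂)
                  (inst : AddOn.Instance F) (K : ℕ) where
  open AddOn F
  open ArchimedeanOrderedField F using (Carrier; 0#; _≤?_; _+_; _-_; _*_)
  open Instance inst
  open Algorithm inst K

  -- The witnesses of distance and of choice below are local functions of roundᵗ
  -- and supportᵗ, which are out of scope here; unification recovers them.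
  distance : ∀ x → Σ[ f ∈ (Fin (suc K) → Timed Carrier) ]
                   roundᵗ x ≡ (argmaxᵗ f (zero ∷ List.tabulate suc) >>= return ∘ proj₁)
  distance x = _ , ≡.refl

  -distanceᵗ : Carrier → Fin (suc K) → Timed Carrier
  -distanceᵗ x = proj₁ (distance x)

  module Support (Sˢ : List⁺ (Fin nˢ)) (Sᵖ : List⁺ (Fin nˢ × Fin nᵃ)) (j : ℕ) where

    open SupportDecision (value (supportᵗ Sˢ Sᵖ j)) public

    γ : Carrier
    γ = value (gridᵗ j)

    -- From here on the tables bound inside `supportᵗ` are restated with their step counts
    -- evaluated, and agree with it by computation. The 4 stands for three products and a sum.
    regularᵗ : Fin M → Fin nˢ → Timed Carrier
    regularᵗ m p = timed (αˢ m p * Ωˢ p + γ * β m p * Ωˢ p) 4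

    discountedᵗ : Fin M → Fin nˢ × Fin nᵃ → Timed Carrier
    discountedᵗ m (p , p′) = timed (αˢ m p * Ωˢ p + γ * β′ m p′ * Ωᵃ p′) 4

    bestRegular : Vec (Fin nˢ × Carrier) M
    bestRegular = value (tabulateᵗ λ m → argmaxᵗ (regularᵗ m) Sˢ)

    bestDiscounted : Vec ((Fin nˢ × Fin nᵃ) × Carrier) M
    bestDiscounted = value (tabulateᵗ λ m → argmaxᵗ (discountedᵗ m) Sᵖ)

    gainᵗ : Fin M → Timed Carrier
    gainᵗ m = step (proj₂ (lookup bestDiscounted m) - proj₂ (lookup bestRegular m))

    gain : Vec Carrier M
    gain = value (tabulateᵗ gainᵗ)

    sorted : List (Fin M)
    sorted = value (sortᵗ (lookup gain) (allFin M))

    discountᵗ : Fin M → Timed Bool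
    discountᵗ m = timed (not (does (lookup gain m ≤? 0#)) ∧ value (amongFirstᵗ S m sorted))
                        (1 ℕ.+ (steps (amongFirstᵗ S m sorted) ℕ.+ 1))

    termᵗ : Fin M → Timed Carrier
    termᵗ m = timed (proj₂ (lookup bestRegular m) + 𝟙 (lookup discount m) * lookup gain m) 2

    choice : Σ[ f ∈ (Fin M → Timed (Fin nˢ × Fin nᵃ)) ] prices ≡ value (tabulateᵗ f)
    choice = _ , ≡.refl

    chooseᵗ : Fin M → Timed (Fin nˢ × Fin nᵃ)
    chooseᵗ = proj₁ choice

  belowᵇ : Fin nˢ × Fin nᵃ → Timed Bool
  belowᵇ (p , p′) = Ωᵃ p′ <ᵗ Ωˢ p

  pairsᵗ : Timed (List (Fin nˢ × Fin nᵃ))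
  pairsᵗ = filterᵗ (λ (p , p′) → Ωᵃ p′ <ᵗ Ωˢ p) (cartesianProduct (allFin nˢ) (allFin nᵃ))

  -- `dispatch` is stuck on its three lists until each is known to be nonempty. A feasible policy
  -- later supplies the witnesses.
  runᵗ-dispatch : ∀ {x xs y ys z zs} → allFin nᶜ ≡ x ∷ xs → allFin nˢ ≡ y ∷ ys → value pairsᵗ ≡ z ∷ zs →
    runᵗ ≡ (pairsᵗ >>= λ _ → solveᵗ (x ∷ xs) (y ∷ ys) (z ∷ zs) >>= λ π → return (just π))
  runᵗ-dispatch e₁ e₂ e₃ rewrite e₃ | e₁ | e₂ = ≡.refl

-- Running time

module _ {a} {A : Set a} where
  open import Data.Nat.Base using (_+_; _*_; _≤_)

  tabulateᵗ-steps : ∀ {n} (f : Fin n → Timed A) b → (∀ i → steps (f i) ≤ b) →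
                    steps (tabulateᵗ f) ≤ n * suc b
  tabulateᵗ-steps {zero}  f b f≤b = z≤n
  tabulateᵗ-steps {suc n} f b f≤b = begin
    steps (f zero) + (steps (tabulateᵗ (f ∘ suc)) + 1) ≤⟨ ℕ.+-mono-≤ (f≤b zero) (ℕ.+-monoˡ-≤ 1 (tabulateᵗ-steps (f ∘ suc) b (f≤b ∘ suc))) ⟩
    b + (n * suc b + 1)                                ≡⟨ ≡.cong (b +_) (ℕ.+-comm _ 1) ⟩
    b + suc (n * suc b)                                ≡⟨ ℕ.+-suc b _ ⟩
    suc n * suc b                                      ∎
    where open ℕ.≤-Reasoning

  filterᵗ-steps : ∀ (p : A → Timed Bool) b → (∀ x → steps (p x) ≤ b) →
                  ∀ xs → steps (filterᵗ p xs) ≤ length xs * suc b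
  filterᵗ-steps p b p≤b []       = z≤n
  filterᵗ-steps p b p≤b (x ∷ xs) = begin
    steps (p x) + (steps (filterᵗ p xs) + 1) ≤⟨ ℕ.+-mono-≤ (p≤b x) (ℕ.+-monoˡ-≤ 1 (filterᵗ-steps p b p≤b xs)) ⟩
    b + (length xs * suc b + 1)              ≡⟨ ≡.cong (b +_) (ℕ.+-comm _ 1) ⟩
    b + suc (length xs * suc b)              ≡⟨ ℕ.+-suc b _ ⟩
    suc (length xs) * suc b                  ∎
    where open ℕ.≤-Reasoning

  length-filterᵗ : ∀ (p : A → Timed Bool) xs → length (value (filterᵗ p xs)) ≤ length xs
  length-filterᵗ p []       = z≤n
  length-filterᵗ p (x ∷ xs) with value (p x)
  ... | true  = s≤s (length-filterᵗ p xs)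
  ... | false = ℕ.m≤n⇒m≤1+n (length-filterᵗ p xs)

  findᵗ-steps : ∀ (p : A → Timed Bool) d b → (∀ x → steps (p x) ≤ b) →
                ∀ xs → steps (findᵗ p d xs) ≤ suc (length xs) * suc b
  findᵗ-steps p d b p≤b []       = s≤s z≤n
  findᵗ-steps p d b p≤b (x ∷ xs) with value (p x)
  ... | true  = ℕ.m≤n⇒m≤1+n (ℕ.+-mono-≤ (p≤b x) (s≤s z≤n))
  ... | false = ℕ.+-mono-≤ (ℕ.m≤n⇒m≤1+n (p≤b x)) (findᵗ-steps p d b p≤b xs)

amongFirstᵗ-steps : ∀ {n} s (i : Fin n) xs → steps (amongFirstᵗ s i xs) ℕ.≤ suc (length xs)
amongFirstᵗ-steps zero    i xs       = s≤s z≤n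
amongFirstᵗ-steps (suc s) i []       = s≤s z≤n
amongFirstᵗ-steps (suc s) i (x ∷ xs) with does (i Fin.≟ x)
... | true  = s≤s z≤n
... | false = s≤s (amongFirstᵗ-steps s i xs)

module Complexity {c ℓ₁ ℓ₂} (F : ArchimedeanOrderedField c ℓ₁ ℓ₂) where
  open import Data.Nat.Base using (_+_; _*_; _≤_)
  open AddOn F
  open ArchimedeanOrderedField F using (Carrier; 0#; _≤?_; _-_)
  open Optimization F using (sortᵗ-↭)
  private module F = ArchimedeanOrderedField F

  module _ {a} {A : Set a} where

    -- The local function of argmaxᵗ ignores the arguments of argmaxᵗ, so that its
    -- recursive call is argmaxᵗ f (y ∷ ys) by computation.
    argmaxᵗ-steps : ∀ (f : A → Timed Carrier) b → (∀ x → steps (f x) ≤ b) →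
                    ∀ x xs → steps (argmaxᵗ f (x ∷ xs)) ≤ suc (length xs) * suc b
    argmaxᵗ-steps f b f≤b x []       = ℕ.+-monoˡ-≤ 0 (ℕ.m≤n⇒m≤1+n (f≤b x))
    argmaxᵗ-steps f b f≤b x (y ∷ ys) = begin
      steps (f x) + (steps (argmaxᵗ f (y ∷ ys)) + 1) ≤⟨ ℕ.+-mono-≤ (f≤b x) (ℕ.+-monoˡ-≤ 1 (argmaxᵗ-steps f b f≤b y ys)) ⟩
      b + (suc (length ys) * suc b + 1)              ≡⟨ ≡.cong (b +_) (ℕ.+-comm _ 1) ⟩
      b + suc (suc (length ys) * suc b)              ≡⟨ ℕ.+-suc b _ ⟩
      suc (suc (length ys)) * suc b                  ∎
      where open ℕ.≤-Reasoning

    insertᵗ-steps : ∀ (key : A → Carrier) x xs → steps (insertᵗ key x xs) ≤ 1 + length xs * 2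
    insertᵗ-steps key x []       = ℕ.≤-refl
    insertᵗ-steps key x (y ∷ ys) with does (key y ≤? key x)
    ... | true  = s≤s (s≤s z≤n)
    ... | false = s≤s (ℕ.≤-trans (ℕ.+-monoˡ-≤ 1 (insertᵗ-steps key x ys)) (ℕ.≤-reflexive (ℕ.+-comm (1 + length ys * 2) 1)))

    sortᵗ-steps : ∀ (key : A → Carrier) xs → steps (sortᵗ key xs) ≤ length xs * (1 + length xs * 2)
    sortᵗ-steps key []       = z≤n
    sortᵗ-steps key (x ∷ xs) = begin
      steps (sortᵗ key xs) + steps (insertᵗ key x (value (sortᵗ key xs)))
        ≤⟨ ℕ.+-mono-≤ (sortᵗ-steps key xs) (insertᵗ-steps key x (value (sortᵗ key xs))) ⟩
      l * (1 + l * 2) + (1 + length (value (sortᵗ key xs)) * 2)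
        ≡⟨ ≡.cong (λ k → l * (1 + l * 2) + (1 + k * 2)) (↭-length (sortᵗ-↭ key xs)) ⟩
      l * (1 + l * 2) + (1 + l * 2)
        ≡⟨ ℕ.+-comm (l * (1 + l * 2)) (1 + l * 2) ⟩
      suc l * (1 + l * 2)
        ≤⟨ ℕ.*-monoʳ-≤ (suc l) (s≤s (ℕ.*-monoˡ-≤ 2 (ℕ.n≤1+n l))) ⟩
      suc l * (1 + suc l * 2)
        ∎
      where
      open ℕ.≤-Reasoning
      l = length xs

  sumᵗ-steps : ∀ {n} (xs : Vec Carrier n) → steps (sumᵗ xs) ≤ n
  sumᵗ-steps Vec.[]       = z≤n
  sumᵗ-steps (x Vec.∷ xs) = ℕ.≤-trans (ℕ.+-monoˡ-≤ 1 (sumᵗ-steps xs)) (ℕ.≤-reflexive (ℕ.+-comm _ 1))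

  -- The summands follow the order of computation in `supportᵗ`, so monotonicity of addition proves
  -- the bound. The 2 pays for the grid point, each 5 for evaluating a candidate and comparing it,
  -- and every table cell costs one more step for storing it.
  supportBound : ℕ → ℕ → ℕ → ℕ
  supportBound m s a =
    2 + (m * (1 + s * 5) + (m * (1 + s * a * 5) + (m * 2 + (m * (1 + m * 2)
    + (m * (3 + suc m) + (m * (1 + (suc a * 2 + 1)) + (m * 3 + m)))))))

  module _ (inst : Instance) (K : ℕ) where
    open Instance inst
    open Algorithm inst K
    open Components F inst K

    -distanceᵗ-steps : ∀ x k → steps (-distanceᵗ x k) ≤ 5
    -distanceᵗ-steps x k with does (0# ≤? x - value (gridᵗ (Fin.toℕ k)))
    ... | true  = ℕ.≤-refl
    ... | false = ℕ.n≤1+n _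

    roundᵗ-steps : ∀ x → steps (roundᵗ x) ≤ suc K * 6
    roundᵗ-steps x = begin
      steps (argmaxᵗ (-distanceᵗ x) (zero ∷ List.tabulate suc)) + 0 ≡⟨ ℕ.+-identityʳ _ ⟩
      steps (argmaxᵗ (-distanceᵗ x) (zero ∷ List.tabulate suc))     ≤⟨ argmaxᵗ-steps _ 5 (-distanceᵗ-steps x) zero (List.tabulate suc) ⟩
      suc (length (List.tabulate {n = K} Fin.suc)) * 6              ≡⟨ ≡.cong (λ k → suc k * 6) (List.length-tabulate {n = K} Fin.suc) ⟩
      suc K * 6                                                     ∎
      where open ℕ.≤-Reasoning

    module _ (Sˢ : List⁺ (Fin nˢ)) (Sᵖ : List⁺ (Fin nˢ × Fin nᵃ)) (j : ℕ) where
      open Support Sˢ Sᵖ j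

      chooseᵗ-steps : ∀ m → steps (chooseᵗ m) ≤ suc nᵃ * 2 + 1
      chooseᵗ-steps m with lookup discount m
      ... | true  = ℕ.m≤n+m 1 (suc nᵃ * 2)
      ... | false = ℕ.+-monoˡ-≤ 1 (ℕ.≤-trans (findᵗ-steps _ _ 1 (λ _ → ℕ.≤-refl) (allFin nᵃ))
                                 (ℕ.≤-reflexive (≡.cong (λ l → suc l * 2) (length-allFin nᵃ))))

      discountᵗ-steps : ∀ m → steps (discountᵗ m) ≤ 2 + suc M
      discountᵗ-steps m = s≤s (begin
        steps (amongFirstᵗ S m sorted) + 1 ≤⟨ ℕ.+-monoˡ-≤ 1 (amongFirstᵗ-steps S m sorted) ⟩
        suc (length sorted) + 1            ≡⟨ ≡.cong (λ l → suc l + 1) (≡.trans (↭-length (sortᵗ-↭ (lookup gain) (allFin M))) (length-allFin M)) ⟩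
        suc M + 1                          ≡⟨ ℕ.+-comm (suc M) 1 ⟩
        1 + suc M                          ∎)
        where open ℕ.≤-Reasoning

    module _ (y : Fin nˢ) (ys : List (Fin nˢ)) (z : Fin nˢ × Fin nᵃ) (zs : List (Fin nˢ × Fin nᵃ))
             (|Sˢ|≤ : suc (length ys) ≤ nˢ) (|Sᵖ|≤ : suc (length zs) ≤ nˢ * nᵃ) where

      supportᵗ-steps : ∀ j → steps (supportᵗ (y ∷ ys) (z ∷ zs) j) ≤ supportBound M nˢ nᵃ
      supportᵗ-steps j =
        ℕ.+-monoʳ-≤ 2 (ℕ.+-mono-≤ r (ℕ.+-mono-≤ r′ (ℕ.+-mono-≤ gains (ℕ.+-mono-≤ sort
        (ℕ.+-mono-≤ discounts (ℕ.+-mono-≤ choices (ℕ.+-mono-≤ terms R)))))))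
        where
        open Support (y ∷ ys) (z ∷ zs) j
        r : steps (tabulateᵗ λ m → argmaxᵗ (regularᵗ m) (y ∷ ys)) ≤ M * (1 + nˢ * 5)
        r = tabulateᵗ-steps _ _ λ m → ℕ.≤-trans (argmaxᵗ-steps (regularᵗ m) 4 (λ p → ℕ.≤-refl) y ys) (ℕ.*-monoˡ-≤ 5 |Sˢ|≤)
        r′ : steps (tabulateᵗ λ m → argmaxᵗ (discountedᵗ m) (z ∷ zs)) ≤ M * (1 + nˢ * nᵃ * 5)
        r′ = tabulateᵗ-steps _ _ λ m → ℕ.≤-trans (argmaxᵗ-steps (discountedᵗ m) 4 (λ p → ℕ.≤-refl) z zs) (ℕ.*-monoˡ-≤ 5 |Sᵖ|≤)
        gains : steps (tabulateᵗ {n = M} gainᵗ) ≤ M * 2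
        gains = tabulateᵗ-steps gainᵗ 1 λ m → ℕ.≤-refl
        sort : steps (sortᵗ (lookup gain) (allFin M)) ≤ M * (1 + M * 2)
        sort = ≡.subst (λ l → steps (sortᵗ (lookup gain) (allFin M)) ≤ l * (1 + l * 2)) (length-allFin M) (sortᵗ-steps (lookup gain) (allFin M))
        discounts : steps (tabulateᵗ discountᵗ) ≤ M * (3 + suc M)
        discounts = tabulateᵗ-steps discountᵗ _ (discountᵗ-steps (y ∷ ys) (z ∷ zs) j)
        choices : steps (tabulateᵗ chooseᵗ) ≤ M * (1 + (suc nᵃ * 2 + 1))
        choices = tabulateᵗ-steps chooseᵗ _ (chooseᵗ-steps (y ∷ ys) (z ∷ zs) j)
        terms : steps (tabulateᵗ termᵗ) ≤ M * 3
        terms = tabulateᵗ-steps termᵗ 2 λ m → ℕ.≤-refl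
        R : steps (sumᵗ (value (tabulateᵗ termᵗ))) + 0 ≤ M
        R = ℕ.≤-trans (ℕ.≤-reflexive (ℕ.+-identityʳ _)) (sumᵗ-steps (value (tabulateᵗ termᵗ)))

      -- Every stage is charged for N K + 1 cells, so the bound is linear in the number of stages.
      -- The 4 is a cell value and a comparison, and the final 2 pays for retrieving the decision
      -- and the next state.
      backwardᵗ-steps : ∀ x xs α̂ n ι next → n ≤ N →
        steps (backwardᵗ (x ∷ xs) α̂ n ι next) ≤ n * (suc (N * K) * (1 + suc (length xs) * 4) + 2)
      backwardᵗ-steps x xs α̂ zero    ι next n≤N = z≤n
      backwardᵗ-steps x xs α̂ (suc n) ι next n<N = begin
        steps (tabulateᵗ cell) + (steps (backwardᵗ (x ∷ xs) α̂ n (ι ∘ inject₁) _) + 2)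
          ≤⟨ ℕ.+-mono-≤ (tabulateᵗ-steps cell _ λ j → argmaxᵗ-steps _ 3 (λ _ → ℕ.≤-refl) x xs)
                         (ℕ.+-monoˡ-≤ 2 (backwardᵗ-steps x xs α̂ n (ι ∘ inject₁) _ n≤N)) ⟩
        suc (n * K) * b + (n * (suc (N * K) * b + 2) + 2)
          ≤⟨ ℕ.+-monoˡ-≤ _ (ℕ.*-monoˡ-≤ b (s≤s (ℕ.*-monoˡ-≤ K n≤N))) ⟩
        suc (N * K) * b + (n * (suc (N * K) * b + 2) + 2)
          ≡⟨ solve 2 (λ u n → u ⊕ (n ⊗ (u ⊕ con 2) ⊕ con 2) := (u ⊕ con 2) ⊕ n ⊗ (u ⊕ con 2)) ≡.refl (suc (N * K) * b) n ⟩
        suc n * (suc (N * K) * b + 2)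
          ∎
        where
        open ℕ.≤-Reasoning
        open +-*-Solver using (solve; con; _:=_) renaming (_:+_ to _⊕_; _:*_ to _⊗_)
        b = 1 + suc (length xs) * 4
        n≤N = ℕ.<⇒≤ n<N
        cell : Fin (suc (n * K)) → Timed (Fin nᶜ × Carrier)
        cell j = argmaxᵗ (λ p → timed (αᶜ (ι (Fin.fromℕ n)) p F.* Ωᶜ p F.+ next (advance {n} (lookup (lookup α̂ (ι (Fin.fromℕ n))) p) j)) 3) (x ∷ xs)

      solveᵗ-steps : ∀ x xs → suc (length xs) ≤ nᶜ → steps (solveᵗ (x ∷ xs) (y ∷ ys) (z ∷ zs)) ≤
        suc (N * K) * suc (supportBound M nˢ nᵃ)
        + (N * (1 + nᶜ * (1 + suc K * 6)) + N * (suc (N * K) * (1 + nᶜ * 4) + 2))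
      solveᵗ-steps x xs |Sᶜ|≤ =
        ℕ.+-mono-≤ (tabulateᵗ-steps {n = suc (N * K)} (supportᵗ (y ∷ ys) (z ∷ zs) ∘ Fin.toℕ) _ (λ j → supportᵗ-steps (Fin.toℕ j)))
        (ℕ.+-mono-≤ (tabulateᵗ-steps _ _ λ n → tabulateᵗ-steps _ _ λ i → roundᵗ-steps (αᶜ n i))
        (ℕ.≤-trans (ℕ.≤-reflexive (ℕ.+-identityʳ _))
        (ℕ.≤-trans (backwardᵗ-steps x xs _ N _ _ ℕ.≤-refl)
        (ℕ.*-monoʳ-≤ N (ℕ.+-monoˡ-≤ 2 (ℕ.*-monoʳ-≤ (suc (N * K)) (ℕ.+-monoʳ-≤ 1 (ℕ.*-monoˡ-≤ 4 |Sᶜ|≤))))))))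

-- Correctness

lookup-∷ʳ-last : ∀ {a} {A : Set a} {n} (xs : Vec A n) x → lookup (xs ∷ʳ x) (fromℕ n) ≡ x
lookup-∷ʳ-last []       x = ≡.refl
lookup-∷ʳ-last (y ∷ ys) x = lookup-∷ʳ-last ys x

lookup-∷ʳ-inject₁ : ∀ {a} {A : Set a} {n} (xs : Vec A n) x i → lookup (xs ∷ʳ x) (inject₁ i) ≡ lookup xs i
lookup-∷ʳ-inject₁ (y ∷ ys) x zero    = ≡.refl
lookup-∷ʳ-inject₁ (y ∷ ys) x (suc i) = lookup-∷ʳ-inject₁ ys x i

module Correctness {c ℓ₁ ℓ₂} (F : ArchimedeanOrderedField c ℓ₁ ℓ₂)
                   (inst : AddOn.Instance F) (K : ℕ) where
  open OrderedField F
  open AddOn F using (𝟙; argmaxᵗ; module Instance; module Algorithm)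
  open Optimization F
  open Instance inst
  open Algorithm inst K
  open Components F inst K

  0-[x-y]+x≈y : ∀ x y → (0# - (x - y)) + x ≈ y
  0-[x-y]+x≈y x y = begin-equality
    (0# - (x - y)) + x               ≈⟨ +-congˡ (x-y+y≈x x y) ⟨
    (0# - (x - y)) + ((x - y) + y)   ≈⟨ +-assoc _ _ _ ⟨
    ((0# - (x - y)) + (x - y)) + y   ≈⟨ +-congʳ (x-y+y≈x 0# (x - y)) ⟩
    0# + y                           ≈⟨ +-identityˡ y ⟩
    y                                ∎
    where open ≤-Reasoning

  γ : ℕ → Carrier
  γ j = value (gridᵗ j)

  -- Add-on revenue of product `m` per unit of total core demand. Summed over `m`, it is the slope
  -- of the value in that demand.
  bonus : Fin M → Fin nˢ → Fin nᵃ → Bool → Carrier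
  bonus m p p′ b = 𝟙 b * β′ m p′ * Ωᵃ p′ + (1# - 𝟙 b) * β m p * Ωˢ p

  margin : Carrier → Fin M → Fin nˢ → Fin nᵃ → Bool → Carrier
  margin g m p p′ b = αˢ m p * Ωˢ p + g * bonus m p p′ b

  bonus-true : ∀ m p p′ → bonus m p p′ true ≈ β′ m p′ * Ωᵃ p′
  bonus-true m p p′ = begin-equality
    1# * β′ m p′ * Ωᵃ p′ + (1# - 1#) * β m p * Ωˢ p ≈⟨ +-cong (*-congʳ (*-identityˡ _)) (*-congʳ (*-congʳ (-‿inverseʳ 1#))) ⟩
    β′ m p′ * Ωᵃ p′ + 0# * β m p * Ωˢ p             ≈⟨ +-congˡ (trans (*-congʳ (zeroˡ _)) (zeroˡ _)) ⟩
    β′ m p′ * Ωᵃ p′ + 0#                            ≈⟨ +-identityʳ _ ⟩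
    β′ m p′ * Ωᵃ p′                                 ∎
    where open ≤-Reasoning

  bonus-false : ∀ m p p′ → bonus m p p′ false ≈ β m p * Ωˢ p
  bonus-false m p p′ = begin-equality
    0# * β′ m p′ * Ωᵃ p′ + (1# - 0#) * β m p * Ωˢ p ≈⟨ +-cong (trans (*-congʳ (zeroˡ _)) (zeroˡ _)) (*-congʳ (*-congʳ (trans (+-congˡ -0#≈0#) (+-identityʳ 1#)))) ⟩
    0# + 1# * β m p * Ωˢ p                          ≈⟨ +-identityˡ _ ⟩
    1# * β m p * Ωˢ p                               ≈⟨ *-congʳ (*-identityˡ _) ⟩
    β m p * Ωˢ p                                    ∎
    where open ≤-Reasoning

  margin-true : ∀ g m p p′ → margin g m p p′ true ≈ αˢ m p * Ωˢ p + g * β′ m p′ * Ωᵃ p′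
  margin-true g m p p′ = +-congˡ (trans (*-congˡ (bonus-true m p p′)) (sym (*-assoc g _ _)))

  margin-false : ∀ g m p p′ → margin g m p p′ false ≈ αˢ m p * Ωˢ p + g * β m p * Ωˢ p
  margin-false g m p p′ = +-congˡ (trans (*-congˡ (bonus-false m p p′)) (sym (*-assoc g _ _)))

  -- With the core demand frozen at `g`, the supportive part of the value separates into one term
  -- per product.
  sum-margin : ∀ g (pˢ : Fin M → Fin nˢ) (p′ : Fin M → Fin nᵃ) (I : Subset M) →
    sum (λ m → margin g m (pˢ m) (p′ m) (lookup I m)) ≈
    sum (λ m → αˢ m (pˢ m) * Ωˢ (pˢ m)) + g * sum (λ m → bonus m (pˢ m) (p′ m) (lookup I m))
  sum-margin g pˢ p′ I = trans (∑-distrib-+ (λ m → αˢ m (pˢ m) * Ωˢ (pˢ m)) (λ m → g * bonus m (pˢ m) (p′ m) (lookup I m)))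
          (+-congˡ (sym (*-distribˡ-sum g (λ m → bonus m (pˢ m) (p′ m) (lookup I m)))))

  pairs-complete : ∀ {p p′} → Ωᵃ p′ < Ωˢ p → (p , p′) ∈ˡ value pairsᵗ
  pairs-complete {p} {p′} p′<p = ∈-filterᵗ⁺ belowᵇ (∈-cartesianProduct⁺ (∈-allFin p) (∈-allFin p′)) (<ᵗ-true p′<p)

  pairs-sound : ∀ {p p′} → (p , p′) ∈ˡ value pairsᵗ → Ωᵃ p′ < Ωˢ p
  pairs-sound pp′∈ = <ᵗ-true⁻ (All.lookup (filterᵗ-All belowᵇ (cartesianProduct (allFin nˢ) (allFin nᵃ))) pp′∈)

  -- Optimality of the supportive decisions at a fixed state

  module SupportCorrectness {y ys z zs} (Sˢ≡ : allFin nˢ ≡ y ∷ ys) (Sᵖ≡ : value pairsᵗ ≡ z ∷ zs) (j : ℕ) where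
    open Support (y ∷ ys) (z ∷ zs) j hiding (γ)

    pˢ : Fin M → Fin nˢ
    pˢ = proj₁ ∘ lookup prices

    p′ : Fin M → Fin nᵃ
    p′ = proj₂ ∘ lookup prices

    r r′ : Fin M → Carrier
    r m  = proj₂ (lookup bestRegular m)
    r′ m = proj₂ (lookup bestDiscounted m)

    regular≤r : ∀ m p → value (regularᵗ m p) ≤ r m
    regular≤r m p rewrite lookup-tabulateᵗ (λ m → argmaxᵗ (regularᵗ m) (y ∷ ys)) m =
      argmaxᵗ-max (regularᵗ m) y ys (≡.subst (p ∈ˡ_) Sˢ≡ (∈-allFin p))

    regular≡r : ∀ m → value (regularᵗ m (proj₁ (lookup bestRegular m))) ≡ r m
    regular≡r m rewrite lookup-tabulateᵗ (λ m → argmaxᵗ (regularᵗ m) (y ∷ ys)) m =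
      ≡.sym (argmaxᵗ-attains (regularᵗ m) y ys)

    discounted≤r′ : ∀ m {p p′} → Ωᵃ p′ < Ωˢ p → value (discountedᵗ m (p , p′)) ≤ r′ m
    discounted≤r′ m p′<p rewrite lookup-tabulateᵗ (λ m → argmaxᵗ (discountedᵗ m) (z ∷ zs)) m =
      argmaxᵗ-max (discountedᵗ m) z zs (≡.subst (_ ∈ˡ_) Sᵖ≡ (pairs-complete p′<p))

    discounted≡r′ : ∀ m → value (discountedᵗ m (proj₁ (lookup bestDiscounted m))) ≡ r′ m
    discounted≡r′ m rewrite lookup-tabulateᵗ (λ m → argmaxᵗ (discountedᵗ m) (z ∷ zs)) m =
      ≡.sym (argmaxᵗ-attains (discountedᵗ m) z zs)

    bestDiscounted-below : ∀ m → let (p , p′) = proj₁ (lookup bestDiscounted m) in Ωᵃ p′ < Ωˢ p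
    bestDiscounted-below m rewrite lookup-tabulateᵗ (λ m → argmaxᵗ (discountedᵗ m) (z ∷ zs)) m =
      pairs-sound (≡.subst (proj₁ (value (argmaxᵗ (discountedᵗ m) (z ∷ zs))) ∈ˡ_) (≡.sym Sᵖ≡) (argmaxᵗ-∈ (discountedᵗ m) z zs))

    lookup-gain : ∀ m → lookup gain m ≡ r′ m - r m
    lookup-gain = lookup-tabulateᵗ gainᵗ

    lookup-discount : ∀ m → lookup discount m ≡ chosen (lookup gain) S sorted m
    lookup-discount = lookup-tabulateᵗ discountᵗ

    prices-discounted : ∀ m → lookup discount m ≡ true → lookup prices m ≡ proj₁ (lookup bestDiscounted m)
    prices-discounted m e = ≡.trans (lookup-tabulateᵗ chooseᵗ m) (go e)
      where
      go : lookup discount m ≡ true → value (chooseᵗ m) ≡ proj₁ (lookup bestDiscounted m)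
      go e with lookup discount m
      ... | true = ≡.refl

    prices-regular : ∀ m → lookup discount m ≡ false →
      let p = proj₁ (lookup bestRegular m) in lookup prices m ≡ (p , value (belowᵗ (y ∷ ys) (z ∷ zs) p))
    prices-regular m e = ≡.trans (lookup-tabulateᵗ chooseᵗ m) (go e)
      where
      p = proj₁ (lookup bestRegular m)
      go : lookup discount m ≡ false → value (chooseᵗ m) ≡ (p , value (belowᵗ (y ∷ ys) (z ∷ zs) p))
      go e with lookup discount m
      ... | false = ≡.refl

    discount-size : ∣ discount ∣ ℕ.≤ S
    discount-size = greedy-size (lookup gain) S discount lookup-discount

    discount-below : ∀ m → lookup discount m ≡ true → Ωᵃ (p′ m) < Ωˢ (pˢ m)
    discount-below m e rewrite prices-discounted m e = bestDiscounted-below m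

    -- A regular price may be any element of `Ωˢ`, so the existence of an add-on price below it is a
    -- hypothesis here. Given one, the search of `belowᵗ` succeeds.
    prices-below : (∀ p → ∃[ q ] Ωᵃ q < Ωˢ p) → ∀ m → Ωᵃ (p′ m) < Ωˢ (pˢ m)
    prices-below below m with lookup discount m in e
    ... | true  = discount-below m e
    ... | false rewrite prices-regular m e =
      let p = proj₁ (lookup bestRegular m)
          (q , q<p) = below p
      in <ᵗ-true⁻ (findᵗ-satisfies (λ q → belowᵇ (p , q)) (proj₂ z) (∈-allFin q) (<ᵗ-true q<p))

    r+gain≈r′ : ∀ m → r m + 1# * lookup gain m ≈ r′ m
    r+gain≈r′ m = trans (+-congˡ (trans (*-identityˡ _) (reflexive (lookup-gain m)))) (x+[y-x]≈y (r m) (r′ m))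

    r+0≈r : ∀ m → r m + 0# * lookup gain m ≈ r m
    r+0≈r m = trans (+-congˡ (zeroˡ _)) (+-identityʳ _)

    -- The right side is `r′ m` with a discount and `r m` without. Writing it as an affine function
    -- of the indicator gives the form that `greedy-optimal` maximises.
    margin≤ : ∀ m p p′ b → Ωᵃ p′ < Ωˢ p → margin (γ j) m p p′ b ≤ r m + 𝟙 b * lookup gain m
    margin≤ m p p′ true p′<p = begin
      margin (γ j) m p p′ true       ≈⟨ margin-true (γ j) m p p′ ⟩
      value (discountedᵗ m (p , p′)) ≤⟨ discounted≤r′ m p′<p ⟩
      r′ m                           ≈⟨ r+gain≈r′ m ⟨
      r m + 1# * lookup gain m       ∎
      where open ≤-Reasoning
    margin≤ m p p′ false p′<p = begin
      margin (γ j) m p p′ false      ≈⟨ margin-false (γ j) m p p′ ⟩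
      value (regularᵗ m p)           ≤⟨ regular≤r m p ⟩
      r m                            ≈⟨ r+0≈r m ⟨
      r m + 0# * lookup gain m       ∎
      where open ≤-Reasoning

    margin≈ : ∀ m → margin (γ j) m (pˢ m) (p′ m) (lookup discount m) ≈ r m + 𝟙 (lookup discount m) * lookup gain m
    margin≈ m with lookup discount m in e
    ... | true  rewrite prices-discounted m e = begin-equality
      margin (γ j) m _ _ true                                 ≈⟨ margin-true (γ j) m _ _ ⟩
      value (discountedᵗ m (proj₁ (lookup bestDiscounted m))) ≡⟨ discounted≡r′ m ⟩
      r′ m                                                    ≈⟨ r+gain≈r′ m ⟨
      r m + 1# * lookup gain m                                ∎
      where open ≤-Reasoning
    ... | false rewrite prices-regular m e = begin-equality
      margin (γ j) m _ _ false                                ≈⟨ margin-false (γ j) m _ _ ⟩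
      value (regularᵗ m (proj₁ (lookup bestRegular m)))       ≡⟨ regular≡r m ⟩
      r m                                                     ≈⟨ r+0≈r m ⟨
      r m + 0# * lookup gain m                                ∎
      where open ≤-Reasoning

    revenue≈ : sum (λ m → margin (γ j) m (pˢ m) (p′ m) (lookup discount m)) ≈ revenue
    revenue≈ = trans (sum-cong-≋ margin≈) (reflexive (≡.sym (sumᵗ-tabulateᵗ termᵗ)))

    revenue-optimal : ∀ (qˢ : Fin M → Fin nˢ) (q′ : Fin M → Fin nᵃ) (J : Subset M) → ∣ J ∣ ℕ.≤ S →
      (∀ m → Ωᵃ (q′ m) < Ωˢ (qˢ m)) → sum (λ m → margin (γ j) m (qˢ m) (q′ m) (lookup J m)) ≤ revenue
    revenue-optimal qˢ q′ J |J|≤S q′<qˢ = begin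
      sum (λ m → margin (γ j) m (qˢ m) (q′ m) (lookup J m)) ≤⟨ sum-mono-≤ (λ m → margin≤ m (qˢ m) (q′ m) (lookup J m) (q′<qˢ m)) ⟩
      sum (λ m → r m + 𝟙 (lookup J m) * lookup gain m)      ≈⟨ ∑-distrib-+ r _ ⟩
      sum r + sum (λ m → 𝟙 (lookup J m) * lookup gain m)    ≤⟨ +-monoʳ-≤ (sum r) (greedy-optimal (lookup gain) S discount lookup-discount J |J|≤S) ⟩
      sum r + sum (λ m → 𝟙 (lookup discount m) * lookup gain m) ≈⟨ ∑-distrib-+ r _ ⟨
      sum (λ m → r m + 𝟙 (lookup discount m) * lookup gain m) ≡⟨ sumᵗ-tabulateᵗ termᵗ ⟨
      revenue ∎
      where open ≤-Reasoning

  -- Grid points and rounding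

  e : Carrier
  e = ⟨ K ⟩ ⁻¹

  γ-+ : ∀ i j → γ (i ℕ.+ j) ≈ γ i + γ j
  γ-+ i j = trans (*-congʳ (×-homo-+ 1# i j)) (distribʳ e ⟨ i ⟩ ⟨ j ⟩)

  γ-suc : ∀ k → γ (suc k) ≈ γ k + e
  γ-suc k = trans (distribʳ e 1# ⟨ k ⟩) (trans (+-comm _ _) (+-congˡ (*-identityˡ e)))

  module Rounded (1≤K : 1 ℕ.≤ K) where

    γK≈1 : γ K ≈ 1#
    γK≈1 = *-inverseʳ (<⇒≉0 (0<⟨⟩ 1≤K))

    -- Walks down from a grid point above `x` until the next one is below `x`. At the bottom, `γ 0`
    -- vanishes and `0# ≤ x` applies.
    bracket : ∀ {x} → 0# ≤ x → ∀ n → x ≤ γ (suc n) → ∃[ k ] k ℕ.≤ n × γ k ≤ x × x ≤ γ (suc k)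
    bracket 0≤x zero    x≤ = zero , z≤n , ≤-trans (≤-reflexive (zeroˡ e)) 0≤x , x≤
    bracket {x} 0≤x (suc n) x≤ with total x (γ (suc n))
    ... | inj₂ ≤x = suc n , ℕ.≤-refl , ≤x , x≤
    ... | inj₁ x≤′ with bracket 0≤x n x≤′
    ...   | k , k≤n , γk≤x , x≤γk+1 = k , ℕ.m≤n⇒m≤1+n k≤n , γk≤x , x≤γk+1

    bracketK : ∀ {x} → UnitInterval x → ∃[ k ] k ℕ.< K × γ k ≤ x × x ≤ γ (suc k)
    bracketK (0≤x , x≤1) = go K 1≤K (≤-trans x≤1 (≤-reflexive (sym γK≈1)))
      where
      -- `K` is a module parameter, so the case split is made on a variable `L` instead.
      go : ∀ L → 1 ℕ.≤ L → _ ≤ γ L → ∃[ k ] k ℕ.< L × γ k ≤ _ × _ ≤ γ (suc k)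
      go (suc n) _ x≤ with bracket 0≤x n x≤
      ... | k , k≤n , h = k , s≤s k≤n , h

    module _ (x : Carrier) where

      -distance : Fin (suc K) → Carrier
      -distance k = value (-distanceᵗ x k)

      -- `-distance k` is minus the absolute value of `x - γ (toℕ k)`. It lies below both signed
      -- differences, and the two lemmas after the next show that it reaches the one singled out by
      -- the order of `x` and the grid point.
      -distance≤γ-x : ∀ k → -distance k + x ≤ γ (toℕ k)
      -distance≤γ-x k with 0# ≤? x - γ (toℕ k)
      ... | yes 0≤d = ≤-reflexive (0-[x-y]+x≈y x (γ (toℕ k)))
      ... | no  0≰d = ≤-trans (+-mono-≤ x-γ≤0 (≤-trans (x-y≤z⇒x≤z+y x-γ≤0) (≤-reflexive (+-identityˡ _)))) (≤-reflexive (+-identityˡ _))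
        where
        x-γ≤0 : x - γ (toℕ k) ≤ 0#
        x-γ≤0 = proj₁ (≰⇒> 0≰d)

      -distance≤x-γ : ∀ k → -distance k + γ (toℕ k) ≤ x
      -distance≤x-γ k with 0# ≤? x - γ (toℕ k)
      ... | no  0≰d = ≤-reflexive (x-y+y≈x x (γ (toℕ k)))
      ... | yes 0≤d = begin
        (0# - (x - γ (toℕ k))) + γ (toℕ k) ≤⟨ +-monoˡ-≤ _ (x≤z+y⇒x-y≤z (≤-trans 0≤d (≤-reflexive (sym (+-identityˡ _))))) ⟩
        0# + γ (toℕ k)                     ≤⟨ +-monoˡ-≤ _ 0≤d ⟩
        (x - γ (toℕ k)) + γ (toℕ k)        ≈⟨ x-y+y≈x x (γ (toℕ k)) ⟩
        x                                  ∎
        where open ≤-Reasoning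

      γ≤x⇒γ≤-distance+x : ∀ k → γ (toℕ k) ≤ x → γ (toℕ k) ≤ -distance k + x
      γ≤x⇒γ≤-distance+x k γ≤x with 0# ≤? x - γ (toℕ k)
      ... | yes _   = ≤-reflexive (sym (0-[x-y]+x≈y x (γ (toℕ k))))
      ... | no  0≰d = contradiction (x≤y⇒0≤y-x γ≤x) 0≰d

      x≤γ⇒x≤-distance+γ : ∀ k → x ≤ γ (toℕ k) → x ≤ -distance k + γ (toℕ k)
      x≤γ⇒x≤-distance+γ k x≤γ with 0# ≤? x - γ (toℕ k)
      ... | no  _ = ≤-reflexive (sym (x-y+y≈x x (γ (toℕ k))))
      ... | yes _ = begin
        x                                  ≤⟨ x≤γ ⟩
        γ (toℕ k)                          ≈⟨ +-identityˡ _ ⟨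
        0# + γ (toℕ k)                     ≤⟨ +-monoˡ-≤ _ (x≤y⇒0≤y-x (x≤z+y⇒x-y≤z (≤-trans x≤γ (≤-reflexive (sym (+-identityˡ _)))))) ⟩
        (0# - (x - γ (toℕ k))) + γ (toℕ k) ∎
        where open ≤-Reasoning

      private
        k* : Fin (suc K)
        k* = value (roundᵗ x)

        γ* = γ (toℕ k*)

        -distance≤ : ∀ k → -distance k ≤ -distance k*
        -distance≤ k = ≤-trans (argmaxᵗ-max (-distanceᵗ x) zero (List.tabulate suc) (∈-allFin k))
                               (≤-reflexive (reflexive (argmaxᵗ-attains (-distanceᵗ x) zero (List.tabulate suc))))

        w = -distance k*

      -- The two grid points around x are at distances adding up to 1 / K.
      2-distance : UnitInterval x → 0# ≤ w + w + e
      2-distance x∈ with bracketK x∈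
      ... | k , k<K , γk≤x , x≤γk+1 = +-cancelʳ-≤ (γ k + x) (begin
        0# + (γ k + x)                ≈⟨ +-identityˡ _ ⟩
        γ k + x                       ≤⟨ +-mono-≤ below above ⟩
        (w + x) + (w + γ (suc k))     ≈⟨ +-congˡ (+-congˡ (γ-suc k)) ⟩
        (w + x) + (w + (γ k + e))     ≈⟨ solve 4 (λ w x g e → (w ⊕ x) ⊕ (w ⊕ (g ⊕ e)) := (w ⊕ w ⊕ e) ⊕ (g ⊕ x)) refl w x (γ k) e ⟩
        (w + w + e) + (γ k + x)       ∎)
        where
        open ≤-Reasoning
        kᶠ : Fin (suc K)
        kᶠ = fromℕ< (ℕ.m≤n⇒m≤1+n k<K)
        k+1ᶠ : Fin (suc K)
        k+1ᶠ = fromℕ< (s≤s k<K)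
        below : γ k ≤ w + x
        below = ≤-trans (≡.subst (λ i → γ i ≤ x → γ i ≤ -distance kᶠ + x) (Fin.toℕ-fromℕ< (ℕ.m≤n⇒m≤1+n k<K)) (γ≤x⇒γ≤-distance+x kᶠ) γk≤x)
                        (+-monoˡ-≤ x (-distance≤ kᶠ))
        above : x ≤ w + γ (suc k)
        above = ≤-trans (≡.subst (λ i → x ≤ γ i → x ≤ -distance k+1ᶠ + γ i) (Fin.toℕ-fromℕ< (s≤s k<K)) (x≤γ⇒x≤-distance+γ k+1ᶠ) x≤γk+1)
                        (+-monoˡ-≤ _ (-distance≤ k+1ᶠ))

      -- The distance to the nearest grid point, doubled, is at most `e`. The same computation, with
      -- `x` and `γ*` exchanged, gives both directions.
      roundᵗ-near : UnitInterval x → x + x ≤ γ* + γ* + e × γ* + γ* ≤ x + x + e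
      roundᵗ-near x∈ = near (-distance≤γ-x k*) , near (-distance≤x-γ k*)
        where
        open ≤-Reasoning
        near : ∀ {u v} → w + u ≤ v → u + u ≤ v + v + e
        near {u} {v} w+u≤v = begin
          u + u                     ≈⟨ +-identityˡ _ ⟨
          0# + (u + u)              ≤⟨ +-monoˡ-≤ _ (2-distance x∈) ⟩
          (w + w + e) + (u + u)     ≈⟨ solve 3 (λ w u e → (w ⊕ w ⊕ e) ⊕ (u ⊕ u) := (w ⊕ u) ⊕ (w ⊕ u) ⊕ e) refl w u e ⟩
          (w + u) + (w + u) + e     ≤⟨ +-monoˡ-≤ e (+-mono-≤ w+u≤v w+u≤v) ⟩
          v + v + e                 ∎

  toℕ-advance : ∀ n k j → toℕ (advance {n} k j) ≡ toℕ k ℕ.+ toℕ j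
  toℕ-advance n k j = Fin.toℕ-fromℕ< (s≤s (ℕ.+-mono-≤ (Fin.toℕ≤pred[n] k) (Fin.toℕ≤pred[n] j)))

  -- Exactness of backward induction for rounded demands

  module Backward {x xs} (Sᶜ≡ : allFin nᶜ ≡ x ∷ xs) (α̂ : Rounding) where

    α̂ᶠ : Fin N → Fin nᶜ → Fin (suc K)
    α̂ᶠ n p = lookup (lookup α̂ n) p

    -- Defined for arbitrary core prices, so that those of OPT can be followed through the tables as
    -- well as the retrieved ones.
    state : ∀ n → (Fin n → Fin N) → (Fin n → Fin nᶜ) → Fin (suc (n ℕ.* K))
    state zero    ι q = zero
    state (suc n) ι q = advance {n} (α̂ᶠ (ι (fromℕ n)) (q (fromℕ n))) (state n (ι ∘ inject₁) (q ∘ inject₁))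

    core : ∀ n → (Fin n → Fin N) → (Fin n → Fin nᶜ) → Carrier
    core n ι q = sum (λ i → αᶜ (ι i) (q i) * Ωᶜ (q i))

    -- Restricting `lookup (ps ∷ʳ p*)` along `inject₁` gives `lookup ps` only pointwise.
    state-cong : ∀ n ι {q q′} → (∀ i → q i ≡ q′ i) → state n ι q ≡ state n ι q′
    state-cong zero    ι q≗q′ = ≡.refl
    state-cong (suc n) ι q≗q′ = ≡.cong₂ (λ p → advance {n} (α̂ᶠ (ι (fromℕ n)) p)) (q≗q′ (fromℕ n)) (state-cong n (ι ∘ inject₁) (q≗q′ ∘ inject₁))

    γ-state : ∀ n ι q → γ (toℕ (state n ι q)) ≈ sum (λ i → γ (toℕ (α̂ᶠ (ι i) (q i))))
    γ-state zero    ι q = zeroˡ e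
    γ-state (suc n) ι q = begin-equality
      γ (toℕ (advance {n} k j))                         ≡⟨ ≡.cong γ (toℕ-advance n k j) ⟩
      γ (toℕ k ℕ.+ toℕ j)                               ≈⟨ γ-+ (toℕ k) (toℕ j) ⟩
      γ (toℕ k) + γ (toℕ j)                             ≈⟨ +-congˡ (γ-state n (ι ∘ inject₁) (q ∘ inject₁)) ⟩
      γ (toℕ k) + sum (λ i → γ (toℕ (α̂ᶠ (ι (inject₁ i)) (q (inject₁ i))))) ≈⟨ +-comm _ _ ⟩
      _ + γ (toℕ k)                                     ≈⟨ sum-init-last (λ i → γ (toℕ (α̂ᶠ (ι i) (q i)))) ⟨
      sum (λ i → γ (toℕ (α̂ᶠ (ι i) (q i))))              ∎
      where
      open ≤-Reasoning
      k = α̂ᶠ (ι (fromℕ n)) (q (fromℕ n))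
      j = state n (ι ∘ inject₁) (q ∘ inject₁)

    module Stage n (ι : Fin (suc n) → Fin N) (next : Fin (suc (suc n ℕ.* K)) → Carrier) where

      ι′ : Fin n → Fin N
      ι′ = ι ∘ inject₁

      valueᵗ : Fin (suc (n ℕ.* K)) → Fin nᶜ → Timed Carrier
      valueᵗ j p = timed (αᶜ (ι (fromℕ n)) p * Ωᶜ p + next (advance {n} (α̂ᶠ (ι (fromℕ n)) p) j)) 3

      table : Vec (Fin nᶜ × Carrier) (suc (n ℕ.* K))
      table = value (tabulateᵗ λ j → argmaxᵗ (valueᵗ j) (x ∷ xs))

      next′ : Fin (suc (n ℕ.* K)) → Carrier
      next′ = proj₂ ∘ lookup table

      j : Fin (suc (n ℕ.* K))
      j = proj₁ (value (backwardᵗ (x ∷ xs) α̂ n ι′ next′))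

      ps : Vec (Fin nᶜ) n
      ps = proj₂ (value (backwardᵗ (x ∷ xs) α̂ n ι′ next′))

      p* : Fin nᶜ
      p* = proj₁ (lookup table j)

      cell-max : ∀ j p → value (valueᵗ j p) ≤ next′ j
      cell-max j p rewrite lookup-tabulateᵗ (λ j → argmaxᵗ (valueᵗ j) (x ∷ xs)) j =
        argmaxᵗ-max (valueᵗ j) x xs (≡.subst (p ∈ˡ_) Sᶜ≡ (∈-allFin p))

      cell-attains : ∀ j → next′ j ≡ value (valueᵗ j (proj₁ (lookup table j)))
      cell-attains j rewrite lookup-tabulateᵗ (λ j → argmaxᵗ (valueᵗ j) (x ∷ xs)) j =
        argmaxᵗ-attains (valueᵗ j) x xs

      core-∷ʳ : core (suc n) ι (lookup (ps ∷ʳ p*)) ≈ core n ι′ (lookup ps) + αᶜ (ι (fromℕ n)) p* * Ωᶜ p*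
      core-∷ʳ = trans (sum-init-last λ i → αᶜ (ι i) (lookup (ps ∷ʳ p*) i) * Ωᶜ (lookup (ps ∷ʳ p*) i))
        (+-cong (sum-cong-≋ λ i → reflexive (≡.cong (λ p → αᶜ (ι′ i) p * Ωᶜ p) (lookup-∷ʳ-inject₁ ps p* i)))
                (reflexive (≡.cong (λ p → αᶜ (ι (fromℕ n)) p * Ωᶜ p) (lookup-∷ʳ-last ps p*))))

    backwardᵗ-state : ∀ n ι next → let (j , ps) = value (backwardᵗ (x ∷ xs) α̂ n ι next) in
                      j ≡ state n ι (lookup ps)
    backwardᵗ-state zero    ι next = ≡.refl
    backwardᵗ-state (suc n) ι next = ≡.cong₂ (λ p → advance {n} (α̂ᶠ (ι (fromℕ n)) p))
      (≡.sym (lookup-∷ʳ-last ps p*))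
      (≡.trans (backwardᵗ-state n ι′ next′) (state-cong n ι′ λ i → ≡.sym (lookup-∷ʳ-inject₁ ps p* i)))
      where open Stage n ι next

    -- The induction needs an arbitrary `next`: the last product is absorbed into the table `next′`,
    -- the hypothesis for `next′` handles the earlier products, and the cell retrieved at `j` is
    -- unfolded into its maximising decision.
    backwardᵗ-optimal : ∀ n ι next q → let (j , ps) = value (backwardᵗ (x ∷ xs) α̂ n ι next) in
                        core n ι q + next (state n ι q) ≤ core n ι (lookup ps) + next j
    backwardᵗ-optimal zero    ι next q = ≤-refl
    backwardᵗ-optimal (suc n) ι next q = begin
      core (suc n) ι q + next (state (suc n) ι q)
        ≈⟨ +-congʳ (sum-init-last (λ i → αᶜ (ι i) (q i) * Ωᶜ (q i))) ⟩
      (core n ι′ q′ + αᶜ (ι (fromℕ n)) p * Ωᶜ p) + next (state (suc n) ι q)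
        ≈⟨ +-assoc _ _ _ ⟩
      core n ι′ q′ + value (valueᵗ (state n ι′ q′) p)
        ≤⟨ +-monoʳ-≤ _ (cell-max (state n ι′ q′) p) ⟩
      core n ι′ q′ + next′ (state n ι′ q′)
        ≤⟨ backwardᵗ-optimal n ι′ next′ q′ ⟩
      core n ι′ (lookup ps) + next′ j
        ≡⟨ ≡.cong (core n ι′ (lookup ps) +_) (cell-attains j) ⟩
      core n ι′ (lookup ps) + (αᶜ (ι (fromℕ n)) p* * Ωᶜ p* + next j*)
        ≈⟨ +-assoc _ _ _ ⟨
      (core n ι′ (lookup ps) + αᶜ (ι (fromℕ n)) p* * Ωᶜ p*) + next j*
        ≈⟨ +-congʳ core-∷ʳ ⟨
      core (suc n) ι (lookup (ps ∷ʳ p*)) + next j*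
        ∎
      where
      open ≤-Reasoning
      open Stage n ι next
      q′ = q ∘ inject₁
      p = q (fromℕ n)
      j* = advance {n} (α̂ᶠ (ι (fromℕ n)) p*) j

-- Approximation guarantee

∈⇒∷ : ∀ {a} {A : Set a} {x : A} {xs} → x ∈ˡ xs → ∃₂ λ y ys → xs ≡ y ∷ ys
∈⇒∷ {xs = y ∷ ys} _ = y , ys , ≡.refl

module _ {K : ℕ} (1≤K : 1 ℕ.≤ K) where

  -- Since K is at least one, terms free of K may also be multiplied by it. This and the following
  -- lemmas pull the factor K out of the step bound.
  ≤K* : ∀ x → x ℕ.≤ K ℕ.* x
  ≤K* x = ℕ.≤-trans (ℕ.≤-reflexive (≡.sym (ℕ.*-identityˡ x))) (ℕ.*-monoˡ-≤ x 1≤K)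

  +-≤K* : ∀ {x y x′ y′} → x ℕ.≤ K ℕ.* x′ → y ℕ.≤ K ℕ.* y′ → x ℕ.+ y ℕ.≤ K ℕ.* (x′ ℕ.+ y′)
  +-≤K* x≤ y≤ = ℕ.≤-trans (ℕ.+-mono-≤ x≤ y≤) (ℕ.≤-reflexive (≡.sym (ℕ.*-distribˡ-+ K _ _)))

  *-≤K*ˡ : ∀ {x x′} y → x ℕ.≤ K ℕ.* x′ → x ℕ.* y ℕ.≤ K ℕ.* (x′ ℕ.* y)
  *-≤K*ˡ y x≤ = ℕ.≤-trans (ℕ.*-monoˡ-≤ y x≤) (ℕ.≤-reflexive (ℕ.*-assoc K _ y))

  *-≤K*ʳ : ∀ {y y′} x → y ℕ.≤ K ℕ.* y′ → x ℕ.* y ℕ.≤ K ℕ.* (x ℕ.* y′)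
  *-≤K*ʳ {y} {y′} x y≤ = begin
    x ℕ.* y          ≡⟨ ℕ.*-comm x y ⟩
    y ℕ.* x          ≤⟨ *-≤K*ˡ x y≤ ⟩
    K ℕ.* (y′ ℕ.* x) ≡⟨ ≡.cong (K ℕ.*_) (ℕ.*-comm y′ x) ⟩
    K ℕ.* (x ℕ.* y′) ∎
    where open ℕ.≤-Reasoning

  suc-≤K* : ∀ n → suc (n ℕ.* K) ℕ.≤ K ℕ.* (1 ℕ.+ n)
  suc-≤K* n = +-≤K* (≤K* 1) (ℕ.≤-reflexive (ℕ.*-comm n K))

-- At natural numbers supportPoly computes to supportBound, and stepPoly is the step
-- bound with the factor K taken out.
supportPoly stepPoly : Poly 6
supportPoly =
  con 2 :+ (m :* (con 1 :+ s :* con 5) :+ (m :* (con 1 :+ s :* a :* con 5) :+ (m :* con 2 :+ (m :* (con 1 :+ m :* con 2)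
  :+ (m :* (con 3 :+ (con 1 :+ m)) :+ (m :* (con 1 :+ ((con 1 :+ a) :* con 2 :+ con 1)) :+ (m :* con 3 :+ m)))))))
  where
  m = var 1F
  s = var 3F
  a = var 4F
stepPoly =
  s :* a :* con 2 :+ ((con 1 :+ n) :* (con 1 :+ supportPoly)
  :+ (n :* (con 1 :+ c :* (con 1 :+ con 12)) :+ n :* ((con 1 :+ n) :* (con 1 :+ c :* con 4) :+ con 2)))
  where
  n = var 0F
  c = var 2F
  s = var 3F
  a = var 4F

module MaxPrice {c ℓ₁ ℓ₂} (F : ArchimedeanOrderedField c ℓ₁ ℓ₂) (inst : AddOn.Instance F) where
  open ArchimedeanOrderedField F
  open AddOn.Instance inst

  Ωˢ≤p̂ : ∀ p → Ωˢ p ≤ p̂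
  Ωˢ≤p̂ p = All.lookup (Extrema.xs≤max totalOrder 0# (List.tabulate Ωᶜ List.++ List.tabulate Ωˢ))
                       (∈-++⁺ʳ (List.tabulate Ωᶜ) (∈-tabulate⁺ p))

module Guarantee {c ℓ₁ ℓ₂} (F : ArchimedeanOrderedField c ℓ₁ ℓ₂)
                 (inst : AddOn.Instance F) (K : ℕ) (1≤K : 1 ℕ.≤ K) where
  open OrderedField F
  open AddOn F using (𝟙; Policy; Feasible; V; module Instance; module Algorithm)
  open Optimization F
  open Complexity F
  open Instance inst
  open Algorithm inst K
  open Components F inst K
  open Correctness F inst K
  open Rounded 1≤K
  open MaxPrice F inst

  unit*≤ : ∀ {x y z} → UnitInterval x → 0# ≤ y → y ≤ z → x * y ≤ z
  unit*≤ (_ , x≤1) 0≤y y≤z = ≤-trans (*-monoʳ-≤ 0≤y x≤1) (≤-trans (≤-reflexive (*-identityˡ _)) y≤z)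

  0≤bonus : ∀ m p p′ b → 0# ≤ bonus m p p′ b
  0≤bonus m p p′ true  = ≤-trans (*-nonNegative (proj₁ (β′-unit m p′)) (Ωᵃ-nonNegative p′)) (≤-reflexive (sym (bonus-true m p p′)))
  0≤bonus m p p′ false = ≤-trans (*-nonNegative (proj₁ (β-unit m p)) (Ωˢ-nonNegative p)) (≤-reflexive (sym (bonus-false m p p′)))

  -- `p̂` does not range over add-on prices, so a discounted price is bounded through `p′ < p`. This
  -- is asked for only under a discount, where ALG provides it.
  bonus≤p̂ : ∀ m p p′ b → (b ≡ true → Ωᵃ p′ < Ωˢ p) → bonus m p p′ b ≤ p̂
  bonus≤p̂ m p p′ true  p′<p = ≤-trans (≤-reflexive (bonus-true m p p′))
    (unit*≤ (β′-unit m p′) (Ωᵃ-nonNegative p′) (≤-trans (proj₁ (p′<p ≡.refl)) (Ωˢ≤p̂ p)))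
  bonus≤p̂ m p p′ false _    = ≤-trans (≤-reflexive (bonus-false m p p′))
    (unit*≤ (β-unit m p) (Ωˢ-nonNegative p) (Ωˢ≤p̂ p))

  -- Here a is a total core demand, â its rounding, b the revenue per unit of it, and C
  -- the rest of the value; t bounds twice the rounding error.
  gap : ∀ {a â b a* â* b* C C* t X} →
        â + â ≤ a + a + t → a* + a* ≤ â* + â* + t →
        0# ≤ t → 0# ≤ b → b ≤ X → 0# ≤ b* → b* ≤ X →
        C* + â* * b* ≤ C + â * b → C* + a* * b* ≤ t * X + (C + a * b)
  gap {a} {â} {b} {a*} {â*} {b*} {C} {C*} {t} {X} â≤a a*≤â* 0≤t 0≤b b≤X 0≤b* b*≤X V̂*≤V̂ = x+x≤y+y⇒x≤y (begin
    (C* + a* * b*) + (C* + a* * b*)               ≈⟨ double C* a* b* ⟩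
    (C* + C*) + (a* + a*) * b*                    ≤⟨ +-monoʳ-≤ _ (rounding a*≤â* 0≤b* b*≤X) ⟩
    (C* + C*) + ((â* + â*) * b* + t * X)          ≈⟨ +-assoc _ _ _ ⟨
    (C* + C*) + (â* + â*) * b* + t * X            ≈⟨ +-congʳ (double C* â* b*) ⟨
    (C* + â* * b*) + (C* + â* * b*) + t * X       ≤⟨ +-monoˡ-≤ _ (+-mono-≤ V̂*≤V̂ V̂*≤V̂) ⟩
    (C + â * b) + (C + â * b) + t * X             ≈⟨ +-congʳ (double C â b) ⟩
    (C + C) + (â + â) * b + t * X                 ≤⟨ +-monoˡ-≤ _ (+-monoʳ-≤ _ (rounding â≤a 0≤b b≤X)) ⟩
    -- On the doubled scale each of the two roundings has cost `t * X`, so after halving they cost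
    -- `t * X` together.
    (C + C) + ((a + a) * b + t * X) + t * X       ≈⟨ solve 4 (λ C a b y → (C ⊕ C) ⊕ ((a ⊕ a) ⊗ b ⊕ y) ⊕ y := (y ⊕ (C ⊕ a ⊗ b)) ⊕ (y ⊕ (C ⊕ a ⊗ b))) refl C a b (t * X) ⟩
    (t * X + (C + a * b)) + (t * X + (C + a * b)) ∎)
    where
    open ≤-Reasoning
    double : ∀ C a b → (C + a * b) + (C + a * b) ≈ (C + C) + (a + a) * b
    double = solve 3 (λ C a b → (C ⊕ a ⊗ b) ⊕ (C ⊕ a ⊗ b) := (C ⊕ C) ⊕ (a ⊕ a) ⊗ b) refl
    rounding : ∀ {x y b} → x + x ≤ y + y + t → 0# ≤ b → b ≤ X → (x + x) * b ≤ (y + y) * b + t * X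
    rounding {x} {y} {b} h 0≤b b≤X = begin
      (x + x) * b         ≤⟨ *-monoʳ-≤ 0≤b h ⟩
      (y + y + t) * b     ≈⟨ distribʳ b (y + y) t ⟩
      (y + y) * b + t * b ≤⟨ +-monoʳ-≤ _ (*-monoˡ-≤ 0≤t b≤X) ⟩
      (y + y) * b + t * X ∎

  2-sum-≤ : ∀ {n} {f g : Fin n → Carrier} → (∀ i → f i + f i ≤ g i + g i + e) →
            sum f + sum f ≤ sum g + sum g + ⟨ n ⟩ * e
  2-sum-≤ {n} {f} {g} f≤g = begin
    sum f + sum f                              ≈⟨ ∑-distrib-+ f f ⟨
    sum (λ i → f i + f i)                      ≤⟨ sum-mono-≤ f≤g ⟩
    sum (λ i → g i + g i + e)                  ≈⟨ ∑-distrib-+ (λ i → g i + g i) (λ _ → e) ⟩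
    sum (λ i → g i + g i) + sum {n} (λ _ → e)  ≤⟨ +-mono-≤ (≤-reflexive (∑-distrib-+ g g)) (sum-≤ {n} e (λ _ → ≤-refl)) ⟩
    sum g + sum g + ⟨ n ⟩ * e                  ∎
    where open ≤-Reasoning

  -- A predicate on the policy alone, so that it can be transported from a freshly computed support
  -- decision to the entry of the table.
  Good : Policy inst → Policy inst → Set _
  Good OPT ALG =
    ∣ I ∣ ℕ.≤ S
    × (∀ m → m ∈ I → Ωᵃ (p′ m) < Ωˢ (pˢ m))
    × ((∀ p → ∃[ q ] Ωᵃ q < Ωˢ p) → Feasible inst ALG)
    × V inst OPT ≤ (⟨ N ⟩ * e) * (⟨ M ⟩ * p̂) + V inst ALG
    where open Policy ALG

  -- The last variable is 1 / ε, which does not occur in stepPoly.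
  sizes : Vec ℕ 6
  sizes = N ∷ M ∷ nᶜ ∷ nˢ ∷ nᵃ ∷ 0 ∷ []

  module _ {x xs y ys z zs} (Sᶜ≡ : allFin nᶜ ≡ x ∷ xs) (Sˢ≡ : allFin nˢ ≡ y ∷ ys)
           (Sᵖ≡ : value pairsᵗ ≡ z ∷ zs) where

    α̂ : Rounding
    α̂ = value (tabulateᵗ λ n → tabulateᵗ (roundᵗ ∘ αᶜ n))

    support : Vec SupportDecision (suc (N ℕ.* K))
    support = value (tabulateᵗ {n = suc (N ℕ.* K)} (supportᵗ (y ∷ ys) (z ∷ zs) ∘ toℕ))

    lookup-support : ∀ j → lookup support j ≡ value (supportᵗ (y ∷ ys) (z ∷ zs) (toℕ j))
    lookup-support = lookup-tabulateᵗ {n = suc (N ℕ.* K)} (supportᵗ (y ∷ ys) (z ∷ zs) ∘ toℕ)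

    open Backward Sᶜ≡ α̂

    α̂-near : ∀ n p → let â = γ (toℕ (α̂ᶠ n p)) in
             αᶜ n p + αᶜ n p ≤ â + â + e × â + â ≤ αᶜ n p + αᶜ n p + e
    α̂-near n p
      rewrite lookup-tabulateᵗ (λ n → tabulateᵗ (roundᵗ ∘ αᶜ n)) n
            | lookup-tabulateᵗ (roundᵗ ∘ αᶜ n) p = roundᵗ-near (αᶜ n p) (αᶜ-unit n p)

    next : Fin (suc (N ℕ.* K)) → Carrier
    next = SupportDecision.revenue ∘ lookup support

    policy : Vec (Fin nᶜ) N → SupportDecision → Policy inst
    policy ps d = record
      { pᶜ = lookup ps
      ; pˢ = proj₁ ∘ lookup (SupportDecision.prices d)
      ; p′ = proj₂ ∘ lookup (SupportDecision.prices d)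
      ; I  = SupportDecision.discount d
      }

    solveᵗ-good : ∀ {OPT} → Feasible inst OPT → Good OPT (value (solveᵗ (x ∷ xs) (y ∷ ys) (z ∷ zs)))
    solveᵗ-good {OPT} (|I|≤S , p′<pˢ) = ≡.subst (λ d → Good OPT (policy ps d)) (≡.sym (lookup-support j))
      ( Alg.discount-size
      , (λ m m∈I → Alg.discount-below m ([]=⇒lookup m∈I))
      , (λ below → Alg.discount-size , Alg.prices-below below)
      , gap
          -- Rounding must not overrate ALG nor underrate OPT, hence the opposite halves of
          -- `α̂-near`.
          (2-sum-≤ (λ n → proj₂ (α̂-near n (lookup ps n))))
          (2-sum-≤ (λ n → proj₁ (α̂-near n (O.pᶜ n))))
          (*-nonNegative (⟨⟩-nonNegative N) (proj₁ (⁻¹-positive (0<⟨⟩ 1≤K))))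
          (sum-nonNegative (λ m → 0≤bonus m (Alg.pˢ m) (Alg.p′ m) (lookup Alg.discount m)))
          (sum-≤ p̂ (λ m → bonus≤p̂ m (Alg.pˢ m) (Alg.p′ m) (lookup Alg.discount m) (Alg.discount-below m)))
          (sum-nonNegative (λ m → 0≤bonus m (O.pˢ m) (O.p′ m) (lookup O.I m)))
          (sum-≤ p̂ (λ m → bonus≤p̂ m (O.pˢ m) (O.p′ m) (lookup O.I m) (λ _ → p′<pˢ m)))
          discretized )
      where
      module O = Policy OPT
      j : Fin (suc (N ℕ.* K))
      j = proj₁ (value (backwardᵗ (x ∷ xs) α̂ N id next))
      ps : Vec (Fin nᶜ) N
      ps = proj₂ (value (backwardᵗ (x ∷ xs) α̂ N id next))
      j* : Fin (suc (N ℕ.* K))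
      j* = state N id O.pᶜ
      module Alg where
        open SupportCorrectness Sˢ≡ Sᵖ≡ (toℕ j) public
        open Support (y ∷ ys) (z ∷ zs) (toℕ j) public using (discount; revenue)
      module Opt where
        open SupportCorrectness Sˢ≡ Sᵖ≡ (toℕ j*) public
        open Support (y ∷ ys) (z ∷ zs) (toℕ j*) public using (revenue)
      open ≤-Reasoning
      core* = core N id O.pᶜ
      core′ = core N id (lookup ps)
      â* = sum (λ n → γ (toℕ (α̂ᶠ n (O.pᶜ n))))
      â  = sum (λ n → γ (toℕ (α̂ᶠ n (lookup ps n))))
      G* = sum (λ m → αˢ m (O.pˢ m) * Ωˢ (O.pˢ m))
      G  = sum (λ m → αˢ m (Alg.pˢ m) * Ωˢ (Alg.pˢ m))
      B* = sum (λ m → bonus m (O.pˢ m) (O.p′ m) (lookup O.I m))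
      B  = sum (λ m → bonus m (Alg.pˢ m) (Alg.p′ m) (lookup Alg.discount m))
      γj≈â : γ (toℕ j) ≈ â
      γj≈â = trans (reflexive (≡.cong (γ ∘ toℕ) (backwardᵗ-state N id next))) (γ-state N id (lookup ps))
      -- OPT is followed to its own terminal state `j*`, where its supportive decisions are beaten
      -- by the table. Backward induction then passes to `j`, where ALG attains the table entry.
      discretized : core* + G* + â* * B* ≤ core′ + G + â * B
      discretized = begin
        core* + G* + â* * B*              ≈⟨ +-assoc _ _ _ ⟩
        core* + (G* + â* * B*)            ≈⟨ +-congˡ (+-congˡ (*-congʳ (γ-state N id O.pᶜ))) ⟨
        core* + (G* + γ (toℕ j*) * B*)    ≈⟨ +-congˡ (sum-margin (γ (toℕ j*)) O.pˢ O.p′ O.I) ⟨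
        core* + sum (λ m → margin (γ (toℕ j*)) m (O.pˢ m) (O.p′ m) (lookup O.I m))
                                          ≤⟨ +-monoʳ-≤ core* (Opt.revenue-optimal O.pˢ O.p′ O.I |I|≤S p′<pˢ) ⟩
        core* + Opt.revenue               ≡⟨ ≡.cong (λ d → core* + SupportDecision.revenue d) (lookup-support j*) ⟨
        core* + next j*                   ≤⟨ backwardᵗ-optimal N id next O.pᶜ ⟩
        core′ + next j                    ≡⟨ ≡.cong (λ d → core′ + SupportDecision.revenue d) (lookup-support j) ⟩
        core′ + Alg.revenue               ≈⟨ +-congˡ Alg.revenue≈ ⟨
        core′ + sum (λ m → margin (γ (toℕ j)) m (Alg.pˢ m) (Alg.p′ m) (lookup Alg.discount m))
                                          ≈⟨ +-congˡ (sum-margin (γ (toℕ j)) Alg.pˢ Alg.p′ Alg.discount) ⟩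
        core′ + (G + γ (toℕ j) * B)       ≈⟨ +-congˡ (+-congˡ (*-congʳ γj≈â)) ⟩
        core′ + (G + â * B)               ≈⟨ +-assoc _ _ _ ⟨
        core′ + G + â * B                 ∎

    |Sᶜ|≤nᶜ : suc (length xs) ℕ.≤ nᶜ
    |Sᶜ|≤nᶜ = ℕ.≤-reflexive (≡.trans (≡.sym (≡.cong length Sᶜ≡)) (length-allFin nᶜ))

    |Sˢ|≤nˢ : suc (length ys) ℕ.≤ nˢ
    |Sˢ|≤nˢ = ℕ.≤-reflexive (≡.trans (≡.sym (≡.cong length Sˢ≡)) (length-allFin nˢ))

    length-pairs : length (cartesianProduct (allFin nˢ) (allFin nᵃ)) ≡ nˢ ℕ.* nᵃ
    length-pairs = ≡.trans (length-cartesianProduct (allFin nˢ) (allFin nᵃ)) (≡.cong₂ ℕ._*_ (length-allFin nˢ) (length-allFin nᵃ))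

    |Sᵖ|≤nˢnᵃ : suc (length zs) ℕ.≤ nˢ ℕ.* nᵃ
    |Sᵖ|≤nˢnᵃ = begin
      suc (length zs)                                   ≡⟨ ≡.cong length Sᵖ≡ ⟨
      length (value pairsᵗ)                             ≤⟨ length-filterᵗ belowᵇ (cartesianProduct (allFin nˢ) (allFin nᵃ)) ⟩
      length (cartesianProduct (allFin nˢ) (allFin nᵃ)) ≡⟨ length-pairs ⟩
      nˢ ℕ.* nᵃ                                         ∎
      where open ℕ.≤-Reasoning

    pairsᵗ-steps : steps pairsᵗ ℕ.≤ nˢ ℕ.* nᵃ ℕ.* 2
    pairsᵗ-steps = ℕ.≤-trans (filterᵗ-steps belowᵇ 1 (λ _ → ℕ.≤-refl) (cartesianProduct (allFin nˢ) (allFin nᵃ)))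
                             (ℕ.≤-reflexive (≡.cong (ℕ._* 2) length-pairs))

    runᵗ-steps : steps pairsᵗ ℕ.+ (steps (solveᵗ (x ∷ xs) (y ∷ ys) (z ∷ zs)) ℕ.+ 0) ℕ.≤
                 K ℕ.* ⟦ stepPoly ⟧ℕ (lookup sizes)
    runᵗ-steps = ℕ.≤-trans
      (ℕ.+-mono-≤ pairsᵗ-steps (ℕ.≤-trans (ℕ.≤-reflexive (ℕ.+-identityʳ _))
        (solveᵗ-steps inst K y ys z zs |Sˢ|≤nˢ |Sᵖ|≤nˢnᵃ x xs |Sᶜ|≤nᶜ)))
      (+-≤K* 1≤K (≤K* 1≤K (nˢ ℕ.* nᵃ ℕ.* 2))
      (+-≤K* 1≤K (*-≤K*ˡ 1≤K (suc (supportBound M nˢ nᵃ)) (suc-≤K* 1≤K N))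
      (+-≤K* 1≤K (*-≤K*ʳ 1≤K N (+-≤K* 1≤K (≤K* 1≤K 1) (*-≤K*ʳ 1≤K nᶜ (+-≤K* 1≤K (≤K* 1≤K 1) sucK*6≤))))
                 (*-≤K*ʳ 1≤K N (+-≤K* 1≤K (*-≤K*ˡ 1≤K (1 ℕ.+ nᶜ ℕ.* 4) (suc-≤K* 1≤K N)) (≤K* 1≤K 2))))))
      where
      -- Origin of the 12 in `stepPoly`: K + 1 is at most 2 K.
      sucK*6≤ : suc K ℕ.* 6 ℕ.≤ K ℕ.* 12
      sucK*6≤ = *-≤K*ˡ 1≤K 6 (ℕ.≤-trans (ℕ.+-monoˡ-≤ K 1≤K) (ℕ.≤-reflexive (≡.trans (≡.cong (K ℕ.+_) (≡.sym (ℕ.+-identityʳ K))) (ℕ.*-comm 2 K))))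

-- Choice of K: relative error and total running time

module Approximation {c ℓ₁ ℓ₂} (F : ArchimedeanOrderedField c ℓ₁ ℓ₂) where
  open OrderedField F
  open AddOn F using (Instance; module Instance; Policy; Feasible; V; discretizedDP)

  module Bounds (inst : Instance) (v* ε : Carrier) (OPT : Policy inst)
    (0<v* : 0# < v*) (0<ε : 0# < ε) (feasible : Feasible inst OPT) (v*≤V : v* ≤ V inst OPT) where
    open Instance inst
    open MaxPrice F inst
    open ≤-Reasoning
    module O = Policy OPT
    ratio = p̂ * ⟨ M ⟩ * ⟨ N ⟩ * (v* * ε) ⁻¹
    K = ⌈ ratio ⌉
    0<v*ε = *-positive 0<v* 0<ε

    n₀ : Fin N
    n₀ = fromℕ< 1≤N
    m₀ : Fin M
    m₀ = fromℕ< 1≤M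

    -- A feasible policy has a nonnegative add-on price strictly below a supportive price. This
    -- makes the ratio positive and hence its ceiling at least one.
    0<p̂ : 0# < p̂
    0<p̂ = ≤-<-trans (Ωᵃ-nonNegative (O.p′ m₀)) (<-≤-trans (proj₂ feasible m₀)
      (Ωˢ≤p̂ (O.pˢ m₀)))

    0<ratio : 0# < ratio
    0<ratio = *-positive (*-positive (*-positive 0<p̂ (0<⟨⟩ 1≤M)) (0<⟨⟩ 1≤N)) (⁻¹-positive 0<v*ε)

    positive-index : ∀ k → 0# < ⟨ k ⟩ → 1 ℕ.≤ k
    positive-index zero    (_ , 0≉0) = contradiction refl 0≉0
    positive-index (suc k) _         = s≤s z≤n

    1≤K : 1 ℕ.≤ K
    1≤K = positive-index K (<-≤-trans 0<ratio (x≤⟨⌈x⌉⟩ ratio))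

    open Guarantee F inst K 1≤K
    open Correctness F inst K using (pairs-complete; e)
    open Components F inst K using (runᵗ-dispatch)

    -- The prices used by OPT show that none of the lists inspected by `runᵗ` is empty.
    cores = ∈⇒∷ (∈-allFin (O.pᶜ n₀))
    supports = ∈⇒∷ (∈-allFin (O.pˢ m₀))
    pairs = ∈⇒∷ (pairs-complete (proj₂ feasible m₀))
    Sᶜ≡ = proj₂ (proj₂ cores)
    Sˢ≡ = proj₂ (proj₂ supports)
    Sᵖ≡ = proj₂ (proj₂ pairs)

    run≡ = runᵗ-dispatch Sᶜ≡ Sˢ≡ Sᵖ≡
    ALG = value (AddOn.Algorithm.solveᵗ F inst K
      (proj₁ cores ∷ proj₁ (proj₂ cores)) (proj₁ supports ∷ proj₁ (proj₂ supports)) (proj₁ pairs ∷ proj₁ (proj₂ pairs)))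
    good = solveᵗ-good Sᶜ≡ Sˢ≡ Sᵖ≡ {OPT} feasible

    error≤ : (⟨ N ⟩ * e) * (⟨ M ⟩ * p̂) ≤ ε * V inst OPT
    error≤ = begin
      (⟨ N ⟩ * e) * (⟨ M ⟩ * p̂)      ≈⟨ solve 4 (λ n e m p → (n ⊗ e) ⊗ (m ⊗ p) := p ⊗ m ⊗ n ⊗ e) refl _ e _ p̂ ⟩
      p̂ * ⟨ M ⟩ * ⟨ N ⟩ * e          ≤⟨ x≤y*z⇒x*z⁻¹≤y (0<⟨⟩ 1≤K) (≤-trans (x*z⁻¹≤y⇒x≤y*z 0<v*ε (x≤⟨⌈x⌉⟩ ratio)) (≤-reflexive (*-comm _ _))) ⟩
      v* * ε                         ≈⟨ *-comm v* ε ⟩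
      ε * v*                         ≤⟨ *-monoˡ-≤ (proj₁ 0<ε) v*≤V ⟩
      ε * V inst OPT                 ∎

    ⟨K⟩≤ : ⟨ K ⟩ ≤ (1# + p̂ * v* ⁻¹) * (⟨ 1 ⟩ + ⟨ M ⟩ * ⟨ N ⟩ * ε ⁻¹)
    ⟨K⟩≤ = begin
      ⟨ K ⟩                                            ≤⟨ ⟨⌈x⌉⟩≤1+x (proj₁ 0<ratio) ⟩
      1# + ratio                                       ≈⟨ +-congˡ (*-congˡ (⁻¹-distrib-* 0<v* 0<ε)) ⟩
      1# + p̂ * ⟨ M ⟩ * ⟨ N ⟩ * (v* ⁻¹ * ε ⁻¹)          ≈⟨ +-congˡ (solve 5 (λ p m n v e → p ⊗ m ⊗ n ⊗ (v ⊗ e) := (p ⊗ v) ⊗ (m ⊗ n ⊗ e)) refl p̂ _ _ (v* ⁻¹) (ε ⁻¹)) ⟩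
      1# + a * b                                       ≈⟨ +-identityʳ _ ⟨
      -- Enlarging `1 + a b` to `(1 + a) (1 + b)` separates `a`, the ratio of `p̂` to `v*`, from the
      -- polynomial part `b`.
      1# + a * b + 0#                                  ≤⟨ +-monoʳ-≤ _ (+-nonNegative 0≤a 0≤b) ⟩
      1# + a * b + (a + b)                             ≈⟨ solve 2 (λ a b → con 1 ⊕ a ⊗ b ⊕ (a ⊕ b) := (con 1 ⊕ a) ⊗ (con 1 ⊕ b)) refl a b ⟩
      (1# + a) * (1# + b)                              ≈⟨ *-congˡ (+-congʳ (sym (+-identityʳ 1#))) ⟩
      (1# + a) * (⟨ 1 ⟩ + b)                           ∎
      where
      a = p̂ * v* ⁻¹
      b = ⟨ M ⟩ * ⟨ N ⟩ * ε ⁻¹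
      0≤a : 0# ≤ a
      0≤a = *-nonNegative (proj₁ 0<p̂) (proj₁ (⁻¹-positive 0<v*))
      0≤b : 0# ≤ b
      0≤b = *-nonNegative (*-nonNegative (⟨⟩-nonNegative M) (⟨⟩-nonNegative N)) (proj₁ (⁻¹-positive 0<ε))

    parameters : Vec Carrier 6
    parameters = ⟨ N ⟩ ∷ ⟨ M ⟩ ∷ ⟨ nᶜ ⟩ ∷ ⟨ nˢ ⟩ ∷ ⟨ nᵃ ⟩ ∷ ε ⁻¹ ∷ []

    ⟨stepPoly⟩≤ : ⟨ ⟦ stepPoly ⟧ℕ (lookup sizes) ⟩ ≤ ⟦ stepPoly ⟧ parameters
    ⟨stepPoly⟩≤ = ⟨⟦⟧⟩≤⟦⟧ stepPoly {lookup sizes} {parameters} λ where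
      0F → ≤-refl
      1F → ≤-refl
      2F → ≤-refl
      3F → ≤-refl
      4F → ≤-refl
      5F → proj₁ (⁻¹-positive 0<ε)

    time : ⟨ steps (discretizedDP inst K) ⟩ ≤
           (1# + p̂ * v* ⁻¹) * ((⟨ 1 ⟩ + ⟨ M ⟩ * ⟨ N ⟩ * ε ⁻¹) * ⟦ stepPoly ⟧ parameters)
    time = begin
      ⟨ steps (discretizedDP inst K) ⟩ ≡⟨ ≡.cong (λ r → ⟨ steps r ⟩) run≡ ⟩
      _                                ≤⟨ ⟨⟩-mono (runᵗ-steps Sᶜ≡ Sˢ≡ Sᵖ≡) ⟩
      _                                ≈⟨ ×1-homo-* K stepCount ⟩
      ⟨ K ⟩ * ⟨ stepCount ⟩            ≤⟨ *-mono-≤ (≤-trans (⟨⟩-nonNegative K) ⟨K⟩≤) (⟨⟩-nonNegative stepCount) ⟨K⟩≤ ⟨stepPoly⟩≤ ⟩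
      (1# + p̂ * v* ⁻¹) * (⟨ 1 ⟩ + ⟨ M ⟩ * ⟨ N ⟩ * ε ⁻¹) * ⟦ stepPoly ⟧ parameters
                                       ≈⟨ *-assoc _ _ _ ⟩
      (1# + p̂ * v* ⁻¹) * ((⟨ 1 ⟩ + ⟨ M ⟩ * ⟨ N ⟩ * ε ⁻¹) * ⟦ stepPoly ⟧ parameters) ∎
      where stepCount = ⟦ stepPoly ⟧ℕ (lookup sizes)

theorem1 : ∀ {c ℓ₁ ℓ₂} (F : ArchimedeanOrderedField c ℓ₁ ℓ₂) →
  let open ArchimedeanOrderedField F
      open AddOn F in
  Σ[ T ∈ Poly 6 ]
  ∀ (inst : Instance) (v* ε : Carrier) (OPT : Policy inst) →
  let open Instance inst
      K   = ⌈ p̂ * ⟨ M ⟩ * ⟨ N ⟩ * (v* * ε) ⁻¹ ⌉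
      run = discretizedDP inst K in
  0# < v* →
  0# < ε →
  IsOptimal inst OPT →
  v* ≤ V inst OPT →
  1 ℕ.≤ K
  × (∃[ ALG ] let open Policy ALG in
       value run ≡ just ALG
       × ∣ I ∣ ℕ.≤ S
       × (∀ m → m ∈ I → Ωᵃ (p′ m) < Ωˢ (pˢ m))
       × ((∀ p → ∃[ q ] Ωᵃ q < Ωˢ p) → Feasible inst ALG)
       × V inst OPT - V inst ALG ≤ ε * V inst OPT)
  × ⟨ steps run ⟩ ≤ (1# + p̂ * v* ⁻¹)
      * ⟦ T ⟧ (⟨ N ⟩ ∷ ⟨ M ⟩ ∷ ⟨ nᶜ ⟩ ∷ ⟨ nˢ ⟩ ∷ ⟨ nᵃ ⟩ ∷ ε ⁻¹ ∷ [])
-- The first factor is what remains of the bound on K once the ratio of `p̂` to `v*` is split off.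
-- The second counts the steps per unit of K.
theorem1 F = (con 1 :+ var 1F :* var 0F :* var 5F) :* stepPoly , λ inst v* ε OPT 0<v* 0<ε (feasible , _) v*≤V →
  let open OrderedField F
      open Approximation.Bounds F inst v* ε OPT 0<v* 0<ε feasible v*≤V
      (|I|≤S , discounted , all-below , V≤) = good
  in 1≤K
   , (ALG , ≡.cong value run≡ , |I|≤S , discounted , all-below , x≤z+y⇒x-y≤z (≤-trans V≤ (+-monoˡ-≤ _ error≤)))
   , time
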